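{- Let $\alpha\ge 1$ be an integer, $\varepsilon\in(0,1/2]$, and let $E_n$ be the number of non-full blocks in the $(\alpha,\varepsilon)$-Randomized Block Search Tree on $n$ keys with uniformly random priority permutation. Then $$\mathbb{E}[E_n]\le\max\{\varepsilon n/\alpha,\;1\}.$$
   Context: $(\alpha,\varepsilon)$-RBST. Fix an integer $\alpha\ge1$ and a real $\varepsilon\in(0,1/2]$. Put $\rho=108\alpha/\varepsilon$ and $\beta=(\alpha+1)\rho$; the parameters are assumed to be such that $\beta$ is an integer. For an integer $s\ge0$ define the fan-out bound $\delta(s)=\min\{\alpha+1,\max\{1,\lceil (s-\alpha)/\rho\rceil\}\}$. Let $X$ be a set of $n$ distinct keys from a totally ordered universe and let $\pi:X\to\{1,\dots,n\}$ be a bijection (the priorities), drawn uniformly at random. The tree $T_X(\pi)$ is a rooted tree of blocks, each holding at most $\alpha$ keys, defined recursively for any subset $Y\subseteq X$, $|Y|=s$, arising in the construction (starting with $Y=X$): if $Y=\emptyset$ there is no block; otherwise the root block of the subtree for $Y$ stores the $\min\{\alpha,s\}$ keys of $Y$ of smallest priority. If $s\le\alpha$ this is the only block of the subtree. If $s>\alpha$, the $\delta(s)-1$ keys of smallest priority in $Y$ are the active separators of this block; the remaining $s-\alpha$ keys (those not stored in the block) are partitioned by the active separators, in key order, into $\delta(s)$ (possibly empty) sections, and the subtree of each non-empty section, built recursively, becomes a child of the block. A block is full if it stores exactly $\alpha$ keys and non-full otherwise. -}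

module Defs where

open import Data.Fin.Base using (Fin; zero; punchIn)
open import Data.Fin.Permutation as Perm
  using (Permutation′; _⟨$⟩ʳ_; _⟨$⟩ˡ_; insert; remove)
import Data.Fin.Properties as Finₚ
open import Data.Integer.Base as ℤ using (+_)
open import Data.List.Base
  using (List; []; _∷_; _++_; map; length; take; drop; filter; mapMaybe;
         cartesianProductWith; allFin; tabulate; upTo)
open import Data.List.Membership.Propositional.Properties using (∈-allFin)
open import Data.List.Properties
  using (length-++; length-map; length-tabulate; length-filter; length-drop)
open import Data.List.Relation.Unary.All as All using (All; []; _∷_)
import Data.List.Relation.Unary.All.Properties as Allₚ
open import Data.List.Relation.Unary.Any using (Any; here)
import Data.List.Relation.Unary.Any.Properties as Anyₚ
open import Data.Maybe.Base using (Maybe; just; nothing; maybe′)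
open import Data.Nat.Base as ℕ using (ℕ; zero; suc; _∸_; _!; _≤_; s≤s)
open import Data.Nat.ListAction using (sum)
open import Data.Nat.Properties as ℕₚ using (_≟_; _!≢0)
open import Data.Rational.Base as ℚ using (ℚ; _/_; _÷_; Positive; NonZero)
open import Data.Rational.Properties
  using (pos⇒nonZero; pos*pos⇒pos; 1/pos⇒pos; normalize-pos)
open import Level using (Level)
open import Relation.Binary.Bundles using (StrictTotalOrder)
open import Relation.Binary.PropositionalEquality
  using (_≡_; refl; sym; trans; cong; cong₂)
open import Relation.Nullary.Decidable using (Dec; yes; no; ¬?)

-- Every permutation is listed, up to pointwise equality, and the list has n !
-- entries, so each permutation is listed exactly once.
permutations : ∀ n → List (Permutation′ n)
permutations zero    = Perm.id ∷ []
permutations (suc n) =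
  cartesianProductWith (λ i π → insert i zero π) (allFin (suc n)) (permutations n)

length-permutations : ∀ n → length (permutations n) ≡ n !
length-permutations zero    = refl
length-permutations (suc n) =
  trans (length-product (allFin (suc n)) (permutations n))
        (cong₂ ℕ._*_ (length-tabulate {n = suc n} (λ i → i)) (length-permutations n))
  where
  length-product : ∀ (is : List (Fin (suc n))) (πs : List (Permutation′ n)) →
    length (cartesianProductWith (λ i π → insert i zero π) is πs)
      ≡ length is ℕ.* length πs
  length-product []       πs = refl
  length-product (i ∷ is) πs =
    trans (length-++ (map (insert i zero) πs))
          (cong₂ ℕ._+_ (length-map (insert i zero) πs) (length-product is πs))

permutations-complete : ∀ n (π : Permutation′ n) → Any (π Perm.≈_) (permutations n)
permutations-complete zero    π = here λ ()
permutations-complete (suc n) π =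
  Anyₚ.cartesianProductWith⁺ (λ i σ → insert i zero σ)
    (λ { {y = σ} refl eq → decompose σ eq })
    (∈-allFin i₀)
    (permutations-complete n (remove i₀ π))
  where
  i₀ : Fin (suc n)
  i₀ = π ⟨$⟩ˡ zero

  insert-cong : ∀ (σ τ : Permutation′ n) → σ Perm.≈ τ →
                ∀ j → insert i₀ j σ Perm.≈ insert i₀ j τ
  insert-cong σ τ eq j k with i₀ Finₚ.≟ k
  ... | yes _ = refl
  ... | no  _ = cong (punchIn j) (eq _)

  decompose : ∀ σ → remove i₀ π Perm.≈ σ → π Perm.≈ insert i₀ zero σ
  decompose σ eq k =
    trans (sym (Perm.insert-remove i₀ π k))
    (trans (insert-cong (remove i₀ π) σ eq (π ⟨$⟩ʳ i₀) k)
           (cong (λ j → insert i₀ j σ ⟨$⟩ʳ k) (Perm.inverseʳ π)))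

𝔼 : ∀ n → (Permutation′ n → ℕ) → ℚ
𝔼 n f = + sum (map f (permutations n)) / n !
  where instance _ = n !≢0

data Tree {a : Level} (A : Set a) : Set a where
  block : (keys : List A) (children : List (Tree A)) → Tree A

module _ {a : Level} {A : Set a} where

  mutual
    blocks : Tree A → List (List A)
    blocks (block keys children) = keys ∷ forestBlocks children

    forestBlocks : List (Tree A) → List (List A)
    forestBlocks []       = []
    forestBlocks (t ∷ ts) = blocks t ++ forestBlocks ts

-- Taking ε real instead of rational would add no cases: if β = 108α(α + 1)/ε
-- is an integer, then ε is rational.
module Parameters (α : ℕ) .{{_ : ℕ.NonZero α}} (ε : ℚ) .{{_ : Positive ε}} where

  private instance
    ε≢0 : NonZero ε
    ε≢0 = pos⇒nonZero ε

  ρ : ℚ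
  ρ = (+ (108 ℕ.* α) / 1) ÷ ε

  ρ-positive : Positive ρ
  ρ-positive = pos*pos⇒pos (+ (108 ℕ.* α) / 1) (ℚ.1/ ε)
    where instance
      108α≢0 : ℕ.NonZero (108 ℕ.* α)
      108α≢0 = ℕₚ.m*n≢0 108 α
      108α>0 : Positive (+ (108 ℕ.* α) / 1)
      108α>0 = normalize-pos (108 ℕ.* α) 1
      1/ε>0 : Positive (ℚ.1/ ε)
      1/ε>0 = 1/pos⇒pos ε

  private instance
    ρ≢0 : NonZero ρ
    ρ≢0 = pos⇒nonZero ρ {{ρ-positive}}

  β : ℚ
  β = (+ (α ℕ.+ 1) / 1) ℚ.* ρ

  -- The integer inside ∣_∣ is positive, so ∣_∣ only converts it to ℕ.
  δ : ℕ → ℕ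
  δ s = ℤ.∣ + (α ℕ.+ 1) ℤ.⊓ (+ 1 ℤ.⊔ ℚ.ceiling (((+ s ℤ.- + α) / 1) ÷ ρ)) ∣

-- Throughout, a set of keys is given as a list in order of increasing priority,
-- so that "take k" selects the k keys of smallest priority. Sections are
-- sublists and therefore are again in order of increasing priority.
module RBST {a ℓ₁ ℓ₂ : Level} (U : StrictTotalOrder a ℓ₁ ℓ₂)
            (α : ℕ) .{{_ : ℕ.NonZero α}} (ε : ℚ) .{{_ : Positive ε}} where

  open StrictTotalOrder U using (Carrier; _<?_)
  open Parameters α ε using (δ)

  separators : List Carrier → List Carrier
  separators Y = take (δ (length Y) ∸ 1) Y

  -- The i-th section consists of the unstored keys that are greater than
  -- exactly i of the separators, 0 ≤ i < δ(s).
  sectionIndex : List Carrier → Carrier → ℕ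
  sectionIndex Y x = length (filter (_<? x) (separators Y))

  section : List Carrier → ℕ → List Carrier
  section Y i = filter (λ x → sectionIndex Y x ≟ i) (drop α Y)

  sections : List Carrier → List (List Carrier)
  sections Y = map (section Y) (upTo (δ (length Y)))

  -- The first argument bounds the recursion depth; tree-unfold below shows that
  -- length Y suffices. If length Y ≤ α then drop α Y is empty, hence so are all
  -- sections and the block has no children.
  build : ℕ → List Carrier → Maybe (Tree Carrier)
  build _       []        = nothing
  build zero    (_ ∷ _)   = nothing
  build (suc d) Y@(_ ∷ _) = just (block (take α Y) (mapMaybe (build d) (sections Y)))

  tree : List Carrier → Maybe (Tree Carrier)
  tree Y = build (length Y) Y

  private
    mapMaybe-cong : ∀ {f g : List Carrier → Maybe (Tree Carrier)} {Ys} →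
                    All (λ Y → f Y ≡ g Y) Ys → mapMaybe f Ys ≡ mapMaybe g Ys
    mapMaybe-cong []                         = refl
    mapMaybe-cong {f} {g} {Y ∷ _} (eq ∷ eqs) with f Y | g Y | eq
    ... | just t  | _ | refl = cong (t ∷_) (mapMaybe-cong eqs)
    ... | nothing | _ | refl = mapMaybe-cong eqs

    drop-< : ∀ k .{{_ : ℕ.NonZero k}} (y : Carrier) ys →
             length (drop k (y ∷ ys)) ≤ length ys
    drop-< (suc k) y ys =
      ℕₚ.≤-trans (ℕₚ.≤-reflexive (length-drop k ys)) (ℕₚ.m∸n≤m (length ys) k)

    sections-smaller : ∀ y ys →
      All (λ Z → length Z ≤ length ys) (sections (y ∷ ys))
    sections-smaller y ys = Allₚ.map⁺ (All.universal
      (λ i → ℕₚ.≤-trans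
        (length-filter (λ x → sectionIndex (y ∷ ys) x ≟ i) (drop α (y ∷ ys)))
        (drop-< α y ys))
      (upTo (δ (length (y ∷ ys)))))

    build-depth : ∀ d e Y → length Y ≤ d → length Y ≤ e → build d Y ≡ build e Y
    build-depth _       _       []       _       _       = refl
    build-depth (suc d) (suc e) (y ∷ ys) (s≤s p) (s≤s q) =
      cong (λ ts → just (block (take α (y ∷ ys)) ts))
        (mapMaybe-cong (All.map
          (λ {Z} r → build-depth d e Z (ℕₚ.≤-trans r p) (ℕₚ.≤-trans r q))
          (sections-smaller y ys)))

  tree-unfold : ∀ y ys → let Y = y ∷ ys in
    tree Y ≡ just (block (take α Y) (mapMaybe tree (sections Y)))
  tree-unfold y ys = cong (λ ts → just (block (take α (y ∷ ys)) ts))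
    (mapMaybe-cong (All.map
      (λ {Z} r → build-depth (length ys) (length Z) Z r ℕₚ.≤-refl)
      (sections-smaller y ys)))

  -- X = { key i ∣ i } and key i has priority π(i), counted from 0; hence the
  -- key of priority p is key (π⁻¹(p)).
  T : ∀ {n} → (Fin n → Carrier) → Permutation′ n → Maybe (Tree Carrier)
  T key π = tree (tabulate (λ p → key (π ⟨$⟩ˡ p)))

  Full : List Carrier → Set
  Full keys = length keys ≡ α

  full? : ∀ keys → Dec (Full keys)
  full? keys = length keys ≟ α

  nonFullBlocks : Tree Carrier → ℕ
  nonFullBlocks t = length (filter (λ keys → ¬? (full? keys)) (blocks t))

  E : ∀ {n} → (Fin n → Carrier) → Permutation′ n → ℕ
  E key π = maybe′ nonFullBlocks 0 (T key π)

{-# OPTIONS --safe #-}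
module Submission where

-- Let p/q = ε, w = q α, so that ε/α = p/w and ρ = 108 w/p, and let e_s be the mean number
-- of non-full blocks for s keys. While s − α ≤ ρ every block has at most one child, and there
-- is at most one non-full block. For larger s one shows w e_s ≤ p s − w + 2 w [s < K], where
-- K ≈ 2 w/p = ρ/54, by induction on s: given the keys stored in the root, every section is in
-- uniformly random order, so with D + 1 sections of total size s − α the induction hypothesis
-- yields w e_s ≤ p (s − α) − (D + 1) w + 2 w 𝔼(number of sections smaller than K).
-- It remains to see that this expected number is at most D / 2. Insert the separators one at
-- a time: a new separator increases the number of small sections only if it falls among
-- the first or last few keys of a section, which is unlikely since s > D ρ.

open import Defs
open import Data.Bool.Base using (true; false; if_then_else_)
open import Data.Fin.Base using (Fin; zero; suc; punchIn)
open import Data.Fin.Permutation using (Permutation′; _⟨$⟩ˡ_; insert)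
open import Data.Integer.Base as ℤ using (ℤ; -[1+_]; +[1+_])
import Data.Integer.DivMod as ℤDivMod
import Data.Integer.Properties as ℤₚ
open import Data.List.Base
  using (List; []; _∷_; _++_; map; mapMaybe; length; take; drop; filter; applyUpTo;
         allFin; cartesianProductWith; tabulate)
open import Data.List.Properties
  using (drop-drop; filter-++; filter-all; filter-reject; length-++;
         length-drop; length-filter; length-tabulate; length-take; map-++; map-applyUpTo;
         map-tabulate; map-upTo; map-∘; tabulate-cong; take-take)
open import Data.List.Relation.Binary.Permutation.Propositional
  using (_↭_; ↭-refl; ↭-sym; ↭-trans; prep; swap)
open import Data.List.Relation.Binary.Permutation.Propositional.Properties using (↭-length)
open import Data.List.Relation.Unary.All as All using (All; []; _∷_)
open import Data.List.Relation.Unary.All.Properties using (all-filter)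
open import Data.List.Relation.Unary.AllPairs as AllPairs using (AllPairs; []; _∷_)
import Data.List.Relation.Unary.AllPairs.Properties as AllPairsₚ
open import Data.Maybe.Base using (Maybe; just; nothing; maybe′)
open import Data.Nat.Base as ℕ using (ℕ; zero; suc; z≤n; s≤s)
import Data.Nat.DivMod as ℕDivMod
open import Data.Nat.ListAction using (sum)
open import Data.Nat.ListAction.Properties using (sum-++)
open import Data.Nat.Properties as ℕₚ using (_≟_)
open import Data.Nat.Tactic.RingSolver using (solve-∀)
open import Data.Product.Base using (∃; ∃₂; ∃-syntax; _×_; _,_; proj₁; proj₂)
open import Data.Rational.Base as ℚ
  using (ℚ; mkℚ; ↥_; ↧_; ↧ₙ_; _/_; _÷_; 1/_; ½; 1ℚ; toℚᵘ; Positive)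
import Data.Rational.Properties as ℚₚ
open import Data.Rational.Unnormalised.Base as ℚᵘ using (mkℚᵘ; *≡*; *≤*)
import Data.Rational.Unnormalised.Properties as ℚᵘₚ
open import Data.Sum.Base using (_⊎_; inj₁; inj₂) renaming (swap to swap-⊎)
open import Function.Base using (_∘_; id)
open import Function.Definitions using (Injective)
open import Level using (Level)
open import Relation.Binary.Bundles using (StrictTotalOrder)
open import Relation.Binary.Core using (Rel)
open import Relation.Binary.Definitions using (Transitive; tri<; tri≈; tri>)
  renaming (Decidable to Decidable₂)
open import Relation.Binary.PropositionalEquality
  using (_≡_; _≢_; refl; sym; trans; cong; cong₂; subst; module ≡-Reasoning)
open import Relation.Nullary.Decidable
  using (Dec; does; yes; no; ¬?; dec-true; dec-false; _×-dec_)
open import Relation.Nullary.Negation using (¬_; contradiction)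
open import Relation.Unary using (Pred; Decidable)

private variable
  a ℓ ℓ′ : Level
  A B C : Set a
  P Q : Set ℓ

open import Algebra.Properties.CommutativeSemigroup ℕₚ.+-commutativeSemigroup
  using () renaming (interchange to +-interchange; x∙yz≈y∙xz to +-swap)
open import Algebra.Properties.CommutativeSemigroup ℕₚ.*-commutativeSemigroup
  using () renaming (x∙yz≈y∙xz to *-swapˡ; xy∙z≈xz∙y to *-swapʳ)

-- The obstacle is that small sections recur at every level, so an error charged to each of them
-- would accumulate. The term `- w` is the remedy: the `D + 1` sections supply it `D + 1` times, one
-- copy is kept for the root's own bound, and the other `D` pay for small sections at `2 w` each.
-- This is the origin of the target `D / 2`. The summand `2 w [s < K]` is there because a tree with
-- a single non-full block must also obey the bound, which asks for `p s - w + 2 w [s < K]` to be at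
-- least `w` for every `s`, hence for `p K` to be at least `2 w`. Means are kept as natural numbers:
-- a mean over the orders of `s` keys is represented by the sum over all `s !` orders, computed by
-- drawing keys one at a time without replacement. Conditioning on the root then means stopping this
-- recursion after `α` draws, and ratios of factorials are cross-multiplied. Rational arithmetic is
-- confined to the fan-out and to the final comparison.

module RandomOrders where

  open import Data.Nat.Base using (pred; _+_; _*_; _!; _≤_; _<_)

  -- Indicators, finite sums and counting

  𝟙 : Dec P → ℕ
  𝟙 P? = if does P? then 1 else 0

  𝟙-yes : (P? : Dec P) → P → 𝟙 P? ≡ 1
  𝟙-yes P? p = cong (if_then 1 else 0) (dec-true P? p)

  𝟙-no : (P? : Dec P) → ¬ P → 𝟙 P? ≡ 0
  𝟙-no P? ¬p = cong (if_then 1 else 0) (dec-false P? ¬p)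

  𝟙-mono : (P? : Dec P) (Q? : Dec Q) → (P → Q) → 𝟙 P? ≤ 𝟙 Q?
  𝟙-mono (yes p) Q? f = ℕₚ.≤-reflexive (sym (𝟙-yes Q? (f p)))
  𝟙-mono (no _)  Q? f = z≤n

  𝟙-cong : (P? : Dec P) (Q? : Dec Q) → (P → Q) → (Q → P) → 𝟙 P? ≡ 𝟙 Q?
  𝟙-cong P? Q? f g = ℕₚ.≤-antisym (𝟙-mono P? Q? f) (𝟙-mono Q? P? g)

  𝟙+𝟙¬ : (P? : Dec P) → 𝟙 P? + 𝟙 (¬? P?) ≡ 1
  𝟙+𝟙¬ (yes _) = refl
  𝟙+𝟙¬ (no _)  = refl

  𝟙≤1 : (P? : Dec P) → 𝟙 P? ≤ 1
  𝟙≤1 (yes _) = ℕₚ.≤-refl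
  𝟙≤1 (no _)  = z≤n

  sumUpTo : ℕ → (ℕ → ℕ) → ℕ
  sumUpTo n f = sum (applyUpTo f n)

  sumUpTo-cong : ∀ n {f g : ℕ → ℕ} → (∀ i → f i ≡ g i) → sumUpTo n f ≡ sumUpTo n g
  sumUpTo-cong zero    eq = refl
  sumUpTo-cong (suc n) eq = cong₂ _+_ (eq 0) (sumUpTo-cong n (eq ∘ suc))

  sumUpTo-mono : ∀ n {f g : ℕ → ℕ} → (∀ i → f i ≤ g i) → sumUpTo n f ≤ sumUpTo n g
  sumUpTo-mono zero    le = z≤n
  sumUpTo-mono (suc n) le = ℕₚ.+-mono-≤ (le 0) (sumUpTo-mono n (le ∘ suc))

  sumUpTo-+ : ∀ n (f g : ℕ → ℕ) → sumUpTo n (λ i → f i + g i) ≡ sumUpTo n f + sumUpTo n g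
  sumUpTo-+ zero    f g = refl
  sumUpTo-+ (suc n) f g = trans (cong (f 0 + g 0 +_) (sumUpTo-+ n (f ∘ suc) (g ∘ suc)))
    (+-interchange (f 0) (g 0) _ _)

  sumUpTo-* : ∀ n c (f : ℕ → ℕ) → sumUpTo n (λ i → c * f i) ≡ c * sumUpTo n f
  sumUpTo-* zero    c f = sym (ℕₚ.*-zeroʳ c)
  sumUpTo-* (suc n) c f = trans (cong (c * f 0 +_) (sumUpTo-* n c (f ∘ suc)))
    (sym (ℕₚ.*-distribˡ-+ c (f 0) _))

  sumUpTo-const : ∀ n c → sumUpTo n (λ _ → c) ≡ n * c
  sumUpTo-const zero    c = refl
  sumUpTo-const (suc n) c = cong (c +_) (sumUpTo-const n c)

  sumUpTo-point : ∀ {n j} y → j < n → sumUpTo n (λ i → 𝟙 (j ≟ i) * y) ≡ y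
  sumUpTo-point {suc n} {zero}  y _ = begin
    y + 0 + sumUpTo n (λ _ → 0) ≡⟨ cong (y + 0 +_) (trans (sumUpTo-const n 0) (ℕₚ.*-zeroʳ n)) ⟩
    y + 0 + 0                   ≡⟨ trans (ℕₚ.+-identityʳ _) (ℕₚ.+-identityʳ y) ⟩
    y                           ∎
    where open ≡-Reasoning
  sumUpTo-point {suc n} {suc j} y (s≤s j<n) = trans
    (sumUpTo-cong n (λ i → cong (_* y) (𝟙-cong (suc j ≟ suc i) (j ≟ i) ℕₚ.suc-injective (cong suc))))
    (sumUpTo-point y j<n)

  sum-map-+ : ∀ (φ ψ : A → ℕ) xs → sum (map (λ x → φ x + ψ x) xs) ≡ sum (map φ xs) + sum (map ψ xs)
  sum-map-+ φ ψ []       = refl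
  sum-map-+ φ ψ (x ∷ xs) = trans (cong (φ x + ψ x +_) (sum-map-+ φ ψ xs)) (+-interchange (φ x) (ψ x) _ _)

  sum-map-1 : ∀ (xs : List A) → sum (map (λ _ → 1) xs) ≡ length xs
  sum-map-1 []       = refl
  sum-map-1 (x ∷ xs) = cong suc (sum-map-1 xs)

  module _ {P : Pred A ℓ} (P? : Decidable P) where

    count : List A → ℕ
    count xs = length (filter P? xs)

    count-∷ : ∀ x xs → count (x ∷ xs) ≡ 𝟙 (P? x) + count xs
    count-∷ x xs with does (P? x)
    ... | true  = refl
    ... | false = refl

    sum-map-filter : ∀ (φ : A → ℕ) x xs →
      sum (map φ (filter P? (x ∷ xs))) ≡ 𝟙 (P? x) * φ x + sum (map φ (filter P? xs))
    sum-map-filter φ x xs with does (P? x)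
    ... | true  = cong (_+ sum (map φ (filter P? xs))) (sym (ℕₚ.+-identityʳ (φ x)))
    ... | false = refl

    sum-map-𝟙 : ∀ xs → sum (map (𝟙 ∘ P?) xs) ≡ count xs
    sum-map-𝟙 []       = refl
    sum-map-𝟙 (x ∷ xs) = trans (cong (𝟙 (P? x) +_) (sum-map-𝟙 xs)) (sym (count-∷ x xs))

  module _ {P : Pred A ℓ} {Q : Pred A ℓ′} (P? : Decidable P) (Q? : Decidable Q) where

    count-mono : (∀ {x} → P x → Q x) → ∀ xs → count P? xs ≤ count Q? xs
    count-mono f []       = z≤n
    count-mono f (x ∷ xs) rewrite count-∷ P? x xs | count-∷ Q? x xs =
      ℕₚ.+-mono-≤ (𝟙-mono (P? x) (Q? x) f) (count-mono f xs)

  count-cong : {P : Pred A ℓ} {Q : Pred A ℓ′} (P? : Decidable P) (Q? : Decidable Q) →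
    (∀ {x} → P x → Q x) → (∀ {x} → Q x → P x) → ∀ xs → count P? xs ≡ count Q? xs
  count-cong P? Q? f g xs = ℕₚ.≤-antisym (count-mono P? Q? f xs) (count-mono Q? P? g xs)

  count-¬ : {P : Pred A ℓ} (P? : Decidable P) → ∀ xs → count P? xs + count (¬? ∘ P?) xs ≡ length xs
  count-¬ P? []       = refl
  count-¬ P? (x ∷ xs) rewrite count-∷ P? x xs | count-∷ (¬? ∘ P?) x xs = begin
    𝟙 (P? x) + count P? xs + (𝟙 (¬? (P? x)) + count (¬? ∘ P?) xs) ≡⟨ +-interchange (𝟙 (P? x)) _ _ _ ⟩
    𝟙 (P? x) + 𝟙 (¬? (P? x)) + (count P? xs + count (¬? ∘ P?) xs) ≡⟨ cong₂ _+_ (𝟙+𝟙¬ (P? x)) (count-¬ P? xs) ⟩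
    suc (length xs)                                               ∎
    where
    open ≡-Reasoning

  module _ {P : Pred A ℓ} {Q : Pred A ℓ′} (P? : Decidable P) (Q? : Decidable Q) where

    count-filter : ∀ xs → count P? (filter Q? xs) ≡ count (λ x → Q? x ×-dec P? x) xs
    count-filter []       = refl
    count-filter (x ∷ xs) with does (Q? x)
    ... | false = count-filter xs
    ... | true with does (P? x)
    ...   | true  = cong suc (count-filter xs)
    ...   | false = count-filter xs

  count-drop : {P : Pred A ℓ} (P? : Decidable P) → ∀ k xs → count P? xs ≤ k + count P? (drop k xs)
  count-drop P? zero    xs       = ℕₚ.≤-refl
  count-drop P? (suc k) []       = z≤n
  count-drop P? (suc k) (x ∷ xs) = ℕₚ.≤-trans (ℕₚ.≤-reflexive (count-∷ P? x xs))
    (ℕₚ.+-mono-≤ (𝟙≤1 (P? x)) (count-drop P? k xs))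

  sum-map-filter-cong : {P : Pred A ℓ} (P? : Decidable P) {φ ψ : A → ℕ} →
    (∀ {x} → P x → φ x ≡ ψ x) → ∀ xs → sum (map φ (filter P? xs)) ≡ sum (map ψ (filter P? xs))
  sum-map-filter-cong P? eq []       = refl
  sum-map-filter-cong P? eq (x ∷ xs) with P? x
  ... | yes px = cong₂ _+_ (eq px) (sum-map-filter-cong P? eq xs)
  ... | no  _  = sum-map-filter-cong P? eq xs

  -- Each `x` lies in exactly one fibre, the one over `c x`. Sections enter the proof as such
  -- fibres.
  sum-fibres : ∀ {n} (c : A → ℕ) → (∀ x → c x < n) → ∀ (φ : A → ℕ) xs →
    sumUpTo n (λ i → sum (map φ (filter (λ x → c x ≟ i) xs))) ≡ sum (map φ xs)
  sum-fibres {n = n} c c<n φ []       = trans (sumUpTo-const n 0) (ℕₚ.*-zeroʳ n)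
  sum-fibres {n = n} c c<n φ (x ∷ xs) = begin
    sumUpTo n (λ i → sum (map φ (filter (λ y → c y ≟ i) (x ∷ xs))))
      ≡⟨ sumUpTo-cong n (λ i → sum-map-filter (λ y → c y ≟ i) φ x xs) ⟩
    sumUpTo n (λ i → 𝟙 (c x ≟ i) * φ x + sum (map φ (filter (λ y → c y ≟ i) xs)))
      ≡⟨ sumUpTo-+ n (λ i → 𝟙 (c x ≟ i) * φ x) _ ⟩
    sumUpTo n (λ i → 𝟙 (c x ≟ i) * φ x) + sumUpTo n (λ i → sum (map φ (filter (λ y → c y ≟ i) xs)))
      ≡⟨ cong₂ _+_ (sumUpTo-point (φ x) (c<n x)) (sum-fibres c c<n φ xs) ⟩
    φ x + sum (map φ xs) ∎
    where open ≡-Reasoning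

  count-fibres : ∀ {n} (c : A → ℕ) → (∀ x → c x < n) → ∀ xs →
    sumUpTo n (λ i → count (λ x → c x ≟ i) xs) ≡ length xs
  count-fibres {n = n} c c<n xs = trans
    (sumUpTo-cong n (λ i → sym (sum-map-1 (filter (λ x → c x ≟ i) xs))))
    (trans (sum-fibres c c<n (λ _ → 1) xs) (sum-map-1 xs))

  -- Removal is by position and keeps the order of the other entries, so that facts such as
  -- `filter-Pick-reject` are equations between lists rather than permutations.
  data Pick {A : Set a} (x : A) : List A → List A → Set a where
    here  : ∀ {xs} → Pick x xs (x ∷ xs)
    there : ∀ {y xs ys} → Pick x xs ys → Pick x (y ∷ xs) (y ∷ ys)

  Pick⇒↭ : ∀ {x : A} {xs L} → Pick x xs L → L ↭ x ∷ xs
  Pick⇒↭ here                          = ↭-refl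
  Pick⇒↭ {x = x} (there {y = y} pick) = ↭-trans (prep y (Pick⇒↭ pick)) (swap y x ↭-refl)

  Pick-All : ∀ {P : Pred A ℓ} {x xs L} → Pick x xs L → All P L → All P xs
  Pick-All here         (_ ∷ ps)  = ps
  Pick-All (there pick) (py ∷ ps) = py ∷ Pick-All pick ps

  Pick-AllPairs : ∀ {R : A → A → Set ℓ} {x xs L} → Pick x xs L → AllPairs R L → AllPairs R xs
  Pick-AllPairs here         (_ ∷ ps)  = ps
  Pick-AllPairs (there pick) (py ∷ ps) = Pick-All pick py ∷ Pick-AllPairs pick ps

  Pick-head : ∀ {P : Pred A ℓ} {x xs L} → Pick x xs L → All P L → P x
  Pick-head here         (px ∷ _) = px
  Pick-head (there pick) (_ ∷ ps) = Pick-head pick ps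

  Pick-All⁻ : ∀ {P : Pred A ℓ} {x xs L} → Pick x xs L → P x → All P xs → All P L
  Pick-All⁻ here         px ps        = px ∷ ps
  Pick-All⁻ (there pick) px (py ∷ ps) = py ∷ Pick-All⁻ pick px ps

  Pick-length : ∀ {x : A} {xs L n} → Pick x xs L → length L ≡ suc n → length xs ≡ n
  Pick-length pick eq = ℕₚ.suc-injective (trans (sym (↭-length (Pick⇒↭ pick))) eq)

  module _ {P : Pred A ℓ} (P? : Decidable P) where

    count-Pick : ∀ {x xs L} → Pick x xs L → count P? L ≡ 𝟙 (P? x) + count P? xs
    count-Pick {x} {xs} here = count-∷ P? x xs
    count-Pick {x} (there {y} {xs} {ys} pick)
      rewrite count-∷ P? y xs | count-∷ P? y ys | count-Pick pick = +-swap (𝟙 (P? y)) (𝟙 (P? x)) _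

    count-↭ : ∀ {xs ys} → xs ↭ ys → count P? xs ≡ count P? ys
    count-↭ _↭_.refl = refl
    count-↭ (prep {xs} {ys} x eq)
      rewrite count-∷ P? x xs | count-∷ P? x ys | count-↭ eq = refl
    count-↭ (swap {xs} {ys} x y eq)
      rewrite count-∷ P? x (y ∷ xs) | count-∷ P? y xs | count-∷ P? y (x ∷ ys) | count-∷ P? x ys
      | count-↭ eq = +-swap (𝟙 (P? x)) (𝟙 (P? y)) _
    count-↭ (_↭_.trans eq₁ eq₂) = trans (count-↭ eq₁) (count-↭ eq₂)

    filter-Pick-reject : ∀ {x xs L} → ¬ P x → Pick x xs L → filter P? xs ≡ filter P? L
    filter-Pick-reject {xs = xs} ¬px here = sym (filter-reject P? {xs = xs} ¬px)
    filter-Pick-reject ¬px (there {y} pick) with does (P? y)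
    ... | true  = cong (y ∷_) (filter-Pick-reject ¬px pick)
    ... | false = filter-Pick-reject ¬px pick

  -- Sums over draws without replacement and over orders

  sumPicks : List A → (A → List A → ℕ) → ℕ
  sumPicks []       f = 0
  sumPicks (x ∷ xs) f = f x xs + sumPicks xs (λ y ys → f y (x ∷ ys))

  sumPicks-mono : ∀ (L : List A) {f g : A → List A → ℕ} →
    (∀ {x xs} → Pick x xs L → f x xs ≤ g x xs) → sumPicks L f ≤ sumPicks L g
  sumPicks-mono []       le = z≤n
  sumPicks-mono (x ∷ xs) le = ℕₚ.+-mono-≤ (le here) (sumPicks-mono xs (λ pick → le (there pick)))

  sumPicks-cong : ∀ (L : List A) {f g : A → List A → ℕ} →
    (∀ {x xs} → Pick x xs L → f x xs ≡ g x xs) → sumPicks L f ≡ sumPicks L g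
  sumPicks-cong L eq = ℕₚ.≤-antisym
    (sumPicks-mono L (λ pick → ℕₚ.≤-reflexive (eq pick)))
    (sumPicks-mono L (λ pick → ℕₚ.≤-reflexive (sym (eq pick))))

  sumPicks-+ : ∀ (L : List A) (f g : A → List A → ℕ) →
    sumPicks L (λ x xs → f x xs + g x xs) ≡ sumPicks L f + sumPicks L g
  sumPicks-+ []       f g = refl
  sumPicks-+ (x ∷ xs) f g =
    trans (cong (f x xs + g x xs +_) (sumPicks-+ xs (λ y ys → f y (x ∷ ys)) (λ y ys → g y (x ∷ ys))))
          (+-interchange (f x xs) (g x xs) _ _)

  sumPicks-* : ∀ (L : List A) k (f : A → List A → ℕ) →
    sumPicks L (λ x xs → k * f x xs) ≡ k * sumPicks L f
  sumPicks-* []       k f = sym (ℕₚ.*-zeroʳ k)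
  sumPicks-* (x ∷ xs) k f = trans (cong (k * f x xs +_) (sumPicks-* xs k (λ y ys → f y (x ∷ ys))))
    (sym (ℕₚ.*-distribˡ-+ k (f x xs) _))

  sumPicks-map : ∀ (L : List A) (φ : A → ℕ) → sumPicks L (λ x _ → φ x) ≡ sum (map φ L)
  sumPicks-map []       φ = refl
  sumPicks-map (x ∷ xs) φ = cong (φ x +_) (sumPicks-map xs φ)

  sumPicks-const : ∀ (L : List A) k → sumPicks L (λ _ _ → k) ≡ length L * k
  sumPicks-const []       k = refl
  sumPicks-const (x ∷ xs) k = cong (k +_) (sumPicks-const xs k)

  sumPicks-filter : {P : Pred A ℓ} (P? : Decidable P) (L : List A) (f : A → List A → ℕ) →
    sumPicks (filter P? L) f ≡ sumPicks L (λ x xs → 𝟙 (P? x) * f x (filter P? xs))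
  sumPicks-filter P? []       f = refl
  sumPicks-filter P? (x ∷ xs) f with P? x
  ... | yes _ = cong₂ _+_ (sym (ℕₚ.+-identityʳ _)) (sumPicks-filter P? xs (λ y ys → f y (x ∷ ys)))
  ... | no  _ = sumPicks-filter P? xs f

  -- Σ over the orders of L, of which there are n ! when length L ≡ n (the only
  -- case in which sumPerms is meaningful); equal entries of L are told apart.
  sumPerms : ℕ → List A → (List A → ℕ) → ℕ
  sumPerms zero    L G = G []
  sumPerms (suc n) L G = sumPicks L (λ x xs → sumPerms n xs (λ Y → G (x ∷ Y)))

  sumPerms-mono : ∀ n {L : List A} → length L ≡ n → {G H : List A → ℕ} →
    (∀ {Y} → L ↭ Y → G Y ≤ H Y) → sumPerms n L G ≤ sumPerms n L H
  sumPerms-mono zero    {[]} _  le = le ↭-refl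
  sumPerms-mono (suc n) {L}  eq le = sumPicks-mono L (λ {x} pick →
    sumPerms-mono n (Pick-length pick eq) (λ perm → le (↭-trans (Pick⇒↭ pick) (prep x perm))))

  sumPerms-cong : ∀ n {L : List A} → length L ≡ n → {G H : List A → ℕ} →
    (∀ {Y} → L ↭ Y → G Y ≡ H Y) → sumPerms n L G ≡ sumPerms n L H
  sumPerms-cong n eq G≡H = ℕₚ.≤-antisym
    (sumPerms-mono n eq (λ perm → ℕₚ.≤-reflexive (G≡H perm)))
    (sumPerms-mono n eq (λ perm → ℕₚ.≤-reflexive (sym (G≡H perm))))

  sumPerms-+ : ∀ n {L : List A} → length L ≡ n → (G H : List A → ℕ) →
    sumPerms n L (λ Y → G Y + H Y) ≡ sumPerms n L G + sumPerms n L H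
  sumPerms-+ zero    _ G H = refl
  sumPerms-+ (suc n) {L} eq G H = trans
    (sumPicks-cong L (λ {x} pick → sumPerms-+ n (Pick-length pick eq) (G ∘ (x ∷_)) (H ∘ (x ∷_))))
    (sumPicks-+ L _ _)

  sumPerms-* : ∀ n {L : List A} → length L ≡ n → ∀ k (G : List A → ℕ) →
    sumPerms n L (λ Y → k * G Y) ≡ k * sumPerms n L G
  sumPerms-* zero    _ k G = refl
  sumPerms-* (suc n) {L} eq k G = trans
    (sumPicks-cong L (λ {x} pick → sumPerms-* n (Pick-length pick eq) k (G ∘ (x ∷_))))
    (sumPicks-* L k _)

  sumPerms-const : ∀ n {L : List A} → length L ≡ n → ∀ k → sumPerms n L (λ _ → k) ≡ n ! * k
  sumPerms-const zero    _ k = sym (ℕₚ.+-identityʳ k)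
  sumPerms-const (suc n) {L} eq k = begin
    sumPicks L (λ x xs → sumPerms n xs (λ _ → k))
      ≡⟨ sumPicks-cong L (λ pick → sumPerms-const n (Pick-length pick eq) k) ⟩
    sumPicks L (λ _ _ → n ! * k)  ≡⟨ sumPicks-const L (n ! * k) ⟩
    length L * (n ! * k)          ≡⟨ cong (_* (n ! * k)) eq ⟩
    suc n * (n ! * k)             ≡⟨ ℕₚ.*-assoc (suc n) (n !) k ⟨
    suc n ! * k                   ∎
    where open ≡-Reasoning

  sumPerms-sumUpTo : ∀ n {L : List A} → length L ≡ n → ∀ k (G : ℕ → List A → ℕ) →
    sumPerms n L (λ Y → sumUpTo k (λ i → G i Y)) ≡ sumUpTo k (λ i → sumPerms n L (G i))
  sumPerms-sumUpTo n eq zero    G = trans (sumPerms-const n eq 0) (ℕₚ.*-zeroʳ (n !))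
  sumPerms-sumUpTo n eq (suc k) G = trans
    (sumPerms-+ n eq (G 0) (λ Y → sumUpTo k (λ i → G (suc i) Y)))
    (cong (_ +_) (sumPerms-sumUpTo n eq k (G ∘ suc)))

  -- Restricted to a subset, a uniformly random order is uniformly random.
  sumPerms-filter : {P : Pred A ℓ} (P? : Decidable P) →
    ∀ n {L : List A} → length L ≡ n → ∀ z → count P? L ≡ z → (G : List A → ℕ) →
    z ! * sumPerms n L (λ Y → G (filter P? Y)) ≡ n ! * sumPerms z (filter P? L) G
  sumPerms-filter P? zero    {[]} _  zero refl G = refl
  sumPerms-filter P? (suc n) {L}  eq z    eqz  G = begin
    z ! * sumPicks L (λ x xs → sumPerms n xs (λ Y → G (filter P? (x ∷ Y))))
      ≡⟨ sumPicks-* L (z !) _ ⟨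
    sumPicks L (λ x xs → z ! * sumPerms n xs (λ Y → G (filter P? (x ∷ Y))))
      -- A first entry satisfying `P` also heads the filtered order and leaves `pred z` accepted
      -- entries; a rejected one leaves the filtered order alone, so each such pick contributes
      -- `n ! * S`.
      ≡⟨ sumPicks-cong L first ⟩
    sumPicks L (λ x xs → n ! * z * (𝟙 (P? x) * sumPerms (pred z) (filter P? xs) (G ∘ (x ∷_)))
                       + n ! * S * 𝟙 (¬? (P? x)))
      ≡⟨ sumPicks-+ L _ _ ⟩
    sumPicks L (λ x xs → n ! * z * (𝟙 (P? x) * sumPerms (pred z) (filter P? xs) (G ∘ (x ∷_))))
      + sumPicks L (λ x xs → n ! * S * 𝟙 (¬? (P? x)))
      ≡⟨ cong₂ _+_ (sumPicks-* L (n ! * z) _) (sumPicks-* L (n ! * S) _) ⟩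
    n ! * z * sumPicks L (λ x xs → 𝟙 (P? x) * sumPerms (pred z) (filter P? xs) (G ∘ (x ∷_)))
      + n ! * S * sumPicks L (λ x xs → 𝟙 (¬? (P? x)))
      ≡⟨ cong₂ (λ u v → n ! * z * u + n ! * S * v)
           (sym (sumPicks-filter P? L (λ x xs → sumPerms (pred z) xs (G ∘ (x ∷_)))))
           (trans (sumPicks-map L _) (sum-map-𝟙 (¬? ∘ P?) L)) ⟩
    n ! * z * sumPicks (filter P? L) (λ x xs → sumPerms (pred z) xs (G ∘ (x ∷_)))
      + n ! * S * count (¬? ∘ P?) L
      ≡⟨ cong (_+ n ! * S * count (¬? ∘ P?) L)
           (trans (ℕₚ.*-assoc (n !) z _) (trans (cong (n ! *_) (unroll z)) (sym (ℕₚ.*-assoc (n !) z S)))) ⟩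
    n ! * z * S + n ! * S * count (¬? ∘ P?) L
      ≡⟨ rearrange (n !) z S _ ⟩
    (z + count (¬? ∘ P?) L) * n ! * S
      ≡⟨ cong (λ k → k * n ! * S) (trans (cong (_+ _) (sym eqz)) (trans (count-¬ P? L) eq)) ⟩
    suc n ! * S ∎
    where
    open ≡-Reasoning
    S : ℕ
    S = sumPerms z (filter P? L) G

    rearrange : ∀ f z s c → f * z * s + f * s * c ≡ (z + c) * f * s
    rearrange = solve-∀

    -- At `z ≡ 0` the value `pred z` is meaningless; the factor `z` annihilates both sides there.
    unroll : ∀ z → z * sumPicks (filter P? L) (λ x xs → sumPerms (pred z) xs (G ∘ (x ∷_)))
                 ≡ z * sumPerms z (filter P? L) G
    unroll zero    = refl
    unroll (suc z) = refl

    accepted : ∀ f z s n t → z * f * s ≡ z * (n * t) → z * f * s ≡ n * z * (1 * t) + n * S * 0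
    accepted f z s n t e = trans e (lemma n z t S)
      where
      lemma : ∀ n z t S → z * (n * t) ≡ n * z * (1 * t) + n * S * 0
      lemma = solve-∀

    first : ∀ {x xs} → Pick x xs L →
      z ! * sumPerms n xs (λ Y → G (filter P? (x ∷ Y)))
        ≡ n ! * z * (𝟙 (P? x) * sumPerms (pred z) (filter P? xs) (G ∘ (x ∷_)))
          + n ! * S * 𝟙 (¬? (P? x))
    first {x} {xs} pick with P? x
    ... | yes px = go z eqz
      where
      go : ∀ z → count P? L ≡ z →
        z ! * sumPerms n xs (λ Y → G (x ∷ filter P? Y))
          ≡ n ! * z * (1 * sumPerms (pred z) (filter P? xs) (G ∘ (x ∷_))) + n ! * S * 0
      go zero    e = contradiction (trans (sym e) (trans (count-Pick P? pick) (cong (_+ count P? xs) (𝟙-yes (P? x) px)))) λ ()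
      go (suc z) e = accepted (z !) (suc z) _ (n !) _ (trans (ℕₚ.*-assoc (suc z) (z !) _)
        (cong (suc z *_) (sumPerms-filter P? n (Pick-length pick eq) z
          (ℕₚ.suc-injective (trans (sym (trans (count-Pick P? pick) (cong (_+ count P? xs) (𝟙-yes (P? x) px)))) e))
          (G ∘ (x ∷_)))))
    ... | no ¬px = trans
      (trans (sumPerms-filter P? n (Pick-length pick eq) z
               (trans (cong length (filter-Pick-reject P? ¬px pick)) eqz) G)
             (cong (λ M → n ! * sumPerms z M G) (filter-Pick-reject P? ¬px pick)))
      (lemma (n !) S z)
      where
      lemma : ∀ n S z → n * S ≡ n * z * 0 + n * S * 1
      lemma = solve-∀

  -- Given the first k entries, the remaining ones are in uniformly random order.
  sumPerms-take-drop : ∀ {R : Rel A ℓ} k n {L : List A} → length L ≡ k + n → AllPairs R L →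
    {G H : List A → List A → ℕ} →
    (∀ ys {zs} → length zs ≡ n → AllPairs R zs → sumPerms n zs (G ys) ≤ sumPerms n zs (H ys)) →
    sumPerms (k + n) L (λ Y → G (take k Y) (drop k Y)) ≤
    sumPerms (k + n) L (λ Y → H (take k Y) (drop k Y))
  sumPerms-take-drop zero    n     eq ps le = le [] eq ps
  sumPerms-take-drop (suc k) n {L} eq ps le = sumPicks-mono L (λ {x} pick →
    sumPerms-take-drop k n (Pick-length pick eq) (Pick-AllPairs pick ps) (le ∘ (x ∷_)))

  -- By `sumPerms-filter`, both sides scale by the same factor `n ! / z !` when the order of the
  -- subset is replaced by that of `L`. Thus a bound for a section can be used inside the order of
  -- all remaining keys.
  sumPerms-filter-mono : {P : Pred A ℓ} (P? : Decidable P) →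
    ∀ n {L : List A} → length L ≡ n → {G H : List A → ℕ} →
    sumPerms (count P? L) (filter P? L) G ≤ sumPerms (count P? L) (filter P? L) H →
    sumPerms n L (λ Y → G (filter P? Y)) ≤ sumPerms n L (λ Y → H (filter P? Y))
  sumPerms-filter-mono P? n {L} eq {G} {H} le = ℕₚ.*-cancelˡ-≤ (z !) {{ℕₚ._!≢0 z}} (begin
    z ! * sumPerms n L (λ Y → G (filter P? Y)) ≡⟨ sumPerms-filter P? n eq z refl G ⟩
    n ! * sumPerms z (filter P? L) G           ≤⟨ ℕₚ.*-monoʳ-≤ (n !) le ⟩
    n ! * sumPerms z (filter P? L) H           ≡⟨ sumPerms-filter P? n eq z refl H ⟨
    z ! * sumPerms n L (λ Y → H (filter P? Y)) ∎)
    where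
    open ℕₚ.≤-Reasoning
    z : ℕ
    z = count P? L

  -- Priority permutations as orders

  sum-cartesianProductWith : ∀ (f : A → B → C) (φ : C → ℕ) xs ys →
    sum (map φ (cartesianProductWith f xs ys)) ≡ sum (map (λ x → sum (map (φ ∘ f x) ys)) xs)
  sum-cartesianProductWith f φ []       ys = refl
  sum-cartesianProductWith f φ (x ∷ xs) ys = begin
    sum (map φ (map (f x) ys ++ cartesianProductWith f xs ys))
      ≡⟨ cong sum (map-++ φ (map (f x) ys) _) ⟩
    sum (map φ (map (f x) ys) ++ map φ (cartesianProductWith f xs ys))
      ≡⟨ sum-++ (map φ (map (f x) ys)) _ ⟩
    sum (map φ (map (f x) ys)) + sum (map φ (cartesianProductWith f xs ys))
      ≡⟨ cong₂ _+_ (cong sum (sym (map-∘ ys))) (sum-cartesianProductWith f φ xs ys) ⟩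
    sum (map (φ ∘ f x) ys) + sum (map (λ x → sum (map (φ ∘ f x) ys)) xs) ∎
    where open ≡-Reasoning

  sumPicks-tabulate : ∀ {n} (key : Fin (suc n) → A) (f : A → List A → ℕ) →
    sumPicks (tabulate key) f ≡ sum (tabulate (λ i → f (key i) (tabulate (key ∘ punchIn i))))
  sumPicks-tabulate {n = zero}  key f = refl
  sumPicks-tabulate {n = suc n} key f = cong (λ k → f (key zero) (tabulate (key ∘ suc)) + k)
    (sumPicks-tabulate (key ∘ suc) (λ x xs → f x (key zero ∷ xs)))

  -- Both recursions choose the key of priority 0 first: under `insert i zero π` it is `key i`, and
  -- the other keys, indexed through `punchIn i`, follow in the order given by `π`.
  sum-permutations : ∀ n (key : Fin n → A) (G : List A → ℕ) →
    sum (map (λ π → G (tabulate (λ p → key (π ⟨$⟩ˡ p)))) (permutations n)) ≡ sumPerms n (tabulate key) G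
  sum-permutations zero    key G = ℕₚ.+-identityʳ (G [])
  sum-permutations (suc n) key G = begin
    sum (map φ (cartesianProductWith (λ i π → insert i zero π) (allFin (suc n)) (permutations n)))
      ≡⟨ sum-cartesianProductWith (λ i π → insert i zero π) φ (allFin (suc n)) (permutations n) ⟩
    sum (map (λ i → sum (map (φ ∘ insert i zero) (permutations n))) (allFin (suc n)))
      ≡⟨ cong sum (map-tabulate id (λ i → sum (map (φ ∘ insert i zero) (permutations n)))) ⟩
    sum (tabulate (λ i → sum (map (φ ∘ insert i zero) (permutations n))))
      ≡⟨ cong sum (tabulate-cong (λ i → sum-permutations n (key ∘ punchIn i) (G ∘ (key i ∷_)))) ⟩
    sum (tabulate (λ i → sumPerms n (tabulate (key ∘ punchIn i)) (G ∘ (key i ∷_))))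
      ≡⟨ sumPicks-tabulate key (λ x xs → sumPerms n xs (G ∘ (x ∷_))) ⟨
    sumPerms (suc n) (tabulate key) G ∎
    where
    open ≡-Reasoning
    φ : Permutation′ (suc n) → ℕ
    φ π = G (tabulate (λ p → key (π ⟨$⟩ˡ p)))

-- Expected number of small sections

module SmallSections where

  open import Data.Nat.Base using (_+_; _*_; _∸_; _!; _≤_; _<_)
  open RandomOrders

  module _ {_⊏_ : Rel A ℓ} (_⊏?_ : Decidable₂ _⊏_) (⊏-trans : Transitive _⊏_) where

    -- Distinctness in a form that survives reversing the order by swapping the two cases, so that
    -- the same lemmas serve both ends of a section.
    Comparable : Rel A ℓ
    Comparable x y = x ⊏ y ⊎ y ⊏ x

    maximum : ∀ x xs → AllPairs Comparable (x ∷ xs) →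
      ∃₂ λ m ys → Pick m ys (x ∷ xs) × All (_⊏ m) ys
    maximum x []        _         = x , [] , here , []
    maximum x (y ∷ xs) (ps ∷ pss) with maximum y xs pss
    ... | m , ys , pick , below with Pick-head pick ps
    ...   | inj₁ x⊏m = m , x ∷ ys , there pick , x⊏m ∷ below
    ...   | inj₂ m⊏x = x , y ∷ xs , here ,
      Pick-All⁻ pick m⊏x (All.map (λ z⊏m → ⊏-trans z⊏m m⊏x) below)

    -- Let `m` be the largest of the elements of rank below `T`. The others all lie below `m`, so
    -- their number is at most the rank of `m`, which is less than `T`.
    count-low-rank : ∀ T xs → AllPairs Comparable xs →
      count (λ q → count (_⊏? q) xs ℕₚ.<? T) xs ≤ T
    count-low-rank T xs distinct
      with filter (λ q → count (_⊏? q) xs ℕₚ.<? T) xs in eq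
         | all-filter (λ q → count (_⊏? q) xs ℕₚ.<? T) xs
         | AllPairsₚ.filter⁺ (λ q → count (_⊏? q) xs ℕₚ.<? T) distinct
    ... | []     | _   | _  = z≤n
    ... | b ∷ bs | low | ps with maximum b bs ps
    ...   | m , ys , pick , below = begin
      suc (length bs)                     ≡⟨ ↭-length (Pick⇒↭ pick) ⟩
      suc (length ys)                     ≡⟨ cong (suc ∘ length) (filter-all (_⊏? m) below) ⟨
      suc (count (_⊏? m) ys)              ≤⟨ s≤s (ℕₚ.m≤n+m _ _) ⟩
      suc (𝟙 (m ⊏? m) + count (_⊏? m) ys) ≡⟨ cong suc (count-Pick (_⊏? m) pick) ⟨
      suc (count (_⊏? m) (b ∷ bs))        ≡⟨ cong (suc ∘ count (_⊏? m)) eq ⟨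
      suc (count (_⊏? m) (filter low? xs)) ≡⟨ cong suc (count-filter (_⊏? m) low? xs) ⟩
      suc (count (λ x → low? x ×-dec (x ⊏? m)) xs) ≤⟨ s≤s (count-mono _ (_⊏? m) proj₂ xs) ⟩
      suc (count (_⊏? m) xs)              ≤⟨ Pick-head pick low ⟩
      T                                   ∎
      where
      open ℕₚ.≤-Reasoning
      low? = λ q → count (_⊏? q) xs ℕₚ.<? T

  -- Part `j` is split into parts `j` and `suc j`, and the later parts shift by one. The old term
  -- `g j` stays in the bound as slack.
  sumUpTo-insert : ∀ d {j} → j ≤ d → {f g : ℕ → ℕ} →
    (∀ {i} → i < j → f i ≤ g i) → (∀ {i} → j < i → f (suc i) ≤ g i) →
    sumUpTo (2 + d) f ≤ sumUpTo (suc d) g + (f j + f (suc j))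
  sumUpTo-insert d {zero} _ {f} {g} _ above = begin
    f 0 + (f 1 + sumUpTo d (λ i → f (2 + i)))
      ≡⟨ rearrange (f 0) (f 1) _ ⟩
    sumUpTo d (λ i → f (2 + i)) + (f 0 + f 1)
      ≤⟨ ℕₚ.+-monoˡ-≤ (f 0 + f 1) (ℕₚ.≤-trans (sumUpTo-mono d (λ i → above (s≤s z≤n))) (ℕₚ.m≤n+m _ (g 0))) ⟩
    g 0 + sumUpTo d (λ i → g (suc i)) + (f 0 + f 1) ∎
    where
    open ℕₚ.≤-Reasoning
    rearrange : ∀ x y z → x + (y + z) ≡ z + (x + y)
    rearrange = solve-∀
  sumUpTo-insert (suc d) {suc j} (s≤s j≤d) {f} {g} below above = begin
    f 0 + sumUpTo (2 + d) (f ∘ suc)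
      ≤⟨ ℕₚ.+-mono-≤ (below (s≤s z≤n)) (sumUpTo-insert d j≤d (below ∘ s≤s) (above ∘ s≤s)) ⟩
    g 0 + (sumUpTo (suc d) (g ∘ suc) + (f (suc j) + f (2 + j)))
      ≡⟨ ℕₚ.+-assoc (g 0) _ _ ⟨
    g 0 + sumUpTo (suc d) (g ∘ suc) + (f (suc j) + f (2 + j)) ∎
    where open ℕₚ.≤-Reasoning

  module Sections {a ℓ₁ ℓ₂} (U : StrictTotalOrder a ℓ₁ ℓ₂) where

    open StrictTotalOrder U
      using (Carrier; irrefl; compare; <-respˡ-≈; module Eq)
      renaming (_<_ to _≺_; _<?_ to _≺?_; trans to ≺-trans; asym to ≺-asym)

    _≻?_ : Decidable₂ (λ x y → y ≺ x)
    x ≻? y = y ≺? x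

    Distinct : List Carrier → Set _
    Distinct = AllPairs (Comparable _≺?_ ≺-trans)

    -- `¬ (y ≺ x)` is the weak order between `x` and `y`; the fibres of such a `c` are intervals in
    -- key order.
    Monotone : (Carrier → ℕ) → Set _
    Monotone c = ∀ {x y} → ¬ (y ≺ x) → c x ≤ c y

    below : List Carrier → Carrier → ℕ
    below S x = count (_≺? x) S

    -- c counts the separators below a key, so that its fibres over 0, …, d are the sections.
    smallSections : ℕ → (Carrier → ℕ) → ℕ → List Carrier → ℕ
    smallSections T c d L = sumUpTo (suc d) (λ i → 𝟙 (count (λ x → c x ≟ i) L ℕₚ.<? T))

    smallSections-cong : ∀ T {c c′ d d′ L L′} → (∀ x → c x ≡ c′ x) → d ≡ d′ → L ↭ L′ →
      smallSections T c d L ≡ smallSections T c′ d′ L′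
    smallSections-cong T {c} {c′} {d} {L = L} {L′} c≡c′ refl perm = sumUpTo-cong (suc d) (λ i →
      cong (λ k → 𝟙 (k ℕₚ.<? T)) (trans
        (count-cong (λ x → c x ≟ i) (λ x → c′ x ≟ i)
          (λ {x} eq → trans (sym (c≡c′ x)) eq) (λ {x} eq → trans (c≡c′ x) eq) L)
        (count-↭ (λ x → c′ x ≟ i) perm)))

    addSeparator : Carrier → (Carrier → ℕ) → Carrier → ℕ
    addSeparator q c x = c x + 𝟙 (q ≺? x)

    addSeparator-below : ∀ {q} c {x} → ¬ (q ≺ x) → addSeparator q c x ≡ c x
    addSeparator-below {q} c {x} ¬q≺x = trans (cong (c x +_) (𝟙-no (q ≺? x) ¬q≺x)) (ℕₚ.+-identityʳ (c x))

    addSeparator-above : ∀ {q} c {x} → q ≺ x → addSeparator q c x ≡ suc (c x)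
    addSeparator-above {q} c {x} q≺x = trans (cong (c x +_) (𝟙-yes (q ≺? x) q≺x)) (ℕₚ.+-comm (c x) 1)

    addSeparator-monotone : ∀ {q} c → Monotone c → Monotone (addSeparator q c)
    addSeparator-monotone {q} c mono {x} {y} ¬y≺x =
      ℕₚ.+-mono-≤ (mono ¬y≺x) (𝟙-mono (q ≺? x) (q ≺? y) q≺y)
      where
      q≺y : q ≺ x → q ≺ y
      q≺y q≺x with compare q y
      ... | tri< q≺y _   _   = q≺y
      ... | tri≈ _   q≈y _   = contradiction (<-respˡ-≈ q≈y q≺x) ¬y≺x
      ... | tri> _   _   y≺q = contradiction (≺-trans y≺q q≺x) ¬y≺x

    addSeparator-≤ : ∀ {q} c {d} → (∀ x → c x ≤ d) → ∀ x → addSeparator q c x ≤ suc d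
    addSeparator-≤ {q} c {d} c≤d x = ℕₚ.≤-trans (ℕₚ.+-mono-≤ (c≤d x) (𝟙≤1 (q ≺? x))) (ℕₚ.≤-reflexive (ℕₚ.+-comm d 1))

    lowInSection highInSection : ℕ → (Carrier → ℕ) → List Carrier → Carrier → ℕ
    lowInSection  T c L q = 𝟙 (count (_≺? q) (filter (λ x → c x ≟ c q) L) ℕₚ.<? T)
    highInSection T c L q = 𝟙 (count (_≻? q) (filter (λ x → c x ≟ c q) L) ℕₚ.<? T)

    module _ {r} {_⊏_ : Rel Carrier r} (_⊏?_ : Decidable₂ _⊏_) (⊏-trans : Transitive _⊏_) where

      low-rank-in-sections : ∀ T {c d} → (∀ x → c x ≤ d) → ∀ L → AllPairs (Comparable _⊏?_ ⊏-trans) L →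
        sum (map (λ q → 𝟙 (count (_⊏? q) (filter (λ x → c x ≟ c q) L) ℕₚ.<? T)) L) ≤ suc d * T
      low-rank-in-sections T {c} {d} c≤d L distinct = begin
        sum (map φ L)
          ≡⟨ sum-fibres c (s≤s ∘ c≤d) φ L ⟨
        sumUpTo (suc d) (λ i → sum (map φ (section i)))
          -- For `q` in section `i` the index `c q` is `i`, so the list in which `q` is ranked no
          -- longer varies with `q` and `count-low-rank` applies.
          ≡⟨ sumUpTo-cong (suc d) (λ i → sum-map-filter-cong (λ x → c x ≟ i)
               {φ = φ} {ψ = λ q → 𝟙 (count (_⊏? q) (section i) ℕₚ.<? T)} (λ { refl → refl }) L) ⟩
        sumUpTo (suc d) (λ i → sum (map (λ q → 𝟙 (count (_⊏? q) (section i) ℕₚ.<? T)) (section i)))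
          ≡⟨ sumUpTo-cong (suc d) (λ i → sum-map-𝟙 (λ q → count (_⊏? q) (section i) ℕₚ.<? T) (section i)) ⟩
        sumUpTo (suc d) (λ i → count (λ q → count (_⊏? q) (section i) ℕₚ.<? T) (section i))
          ≤⟨ sumUpTo-mono (suc d) (λ i → count-low-rank _⊏?_ ⊏-trans T (section i) (AllPairsₚ.filter⁺ _ distinct)) ⟩
        sumUpTo (suc d) (λ _ → T)
          ≡⟨ sumUpTo-const (suc d) T ⟩
        suc d * T ∎
        where
        open ℕₚ.≤-Reasoning
        φ : Carrier → ℕ
        φ q = 𝟙 (count (_⊏? q) (filter (λ x → c x ≟ c q) L) ℕₚ.<? T)
        section : ℕ → List Carrier
        section i = filter (λ x → c x ≟ i) L

    -- A new separator q splits one section; the parts on either side of q are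
    -- small only if q lies close to an end of that section.
    smallSections-split : ∀ T {c d} → Monotone c → (∀ x → c x ≤ d) → ∀ {q L′ L} → Pick q L′ L →
      smallSections T (addSeparator q c) (suc d) L′ ≤
      smallSections T c d L + (lowInSection T c L q + highInSection T c L q)
    smallSections-split T {c} {d} mono c≤d {q} {L′} {L} pick = begin
      sumUpTo (2 + d) new
        ≤⟨ sumUpTo-insert d (c≤d q) below′ above′ ⟩
      smallSections T c d L + (new (c q) + new (suc (c q)))
        ≤⟨ ℕₚ.+-monoʳ-≤ (smallSections T c d L) (ℕₚ.+-mono-≤ left right) ⟩
      smallSections T c d L + (lowInSection T c L q + highInSection T c L q) ∎
      where
      open ℕₚ.≤-Reasoning
      c′ : Carrier → ℕ
      c′ = addSeparator q c
      new old : ℕ → ℕ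
      new i = 𝟙 (count (λ x → c′ x ≟ i) L′ ℕₚ.<? T)
      old i = 𝟙 (count (λ x → c x ≟ i) L ℕₚ.<? T)

      small-mono : ∀ {m n} → m ≤ n → 𝟙 (n ℕₚ.<? T) ≤ 𝟙 (m ℕₚ.<? T)
      small-mono m≤n = 𝟙-mono (_ ℕₚ.<? T) (_ ℕₚ.<? T) (ℕₚ.≤-<-trans m≤n)

      count-L≤L′ : ∀ {p r} {P : Pred Carrier p} {Q : Pred Carrier r} (P? : Decidable P) (Q? : Decidable Q) →
        ¬ P q → (∀ {x} → P x → Q x) → count P? L ≤ count Q? L′
      count-L≤L′ P? Q? ¬Pq f = begin
        count P? L                ≡⟨ count-Pick P? pick ⟩
        𝟙 (P? q) + count P? L′    ≡⟨ cong (_+ count P? L′) (𝟙-no (P? q) ¬Pq) ⟩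
        count P? L′               ≤⟨ count-mono P? Q? f L′ ⟩
        count Q? L′               ∎

      -- By monotonicity, keys of earlier sections are not above `q` and keep their index, while
      -- keys of later sections are above `q` and move up by one.
      below′ : ∀ {i} → i < c q → new i ≤ old i
      below′ {i} i<cq = small-mono (count-L≤L′ (λ x → c x ≟ i) (λ x → c′ x ≟ i)
        (λ { refl → ℕₚ.<-irrefl refl i<cq })
        (λ { refl → addSeparator-below c (λ q≺x → ℕₚ.<⇒≱ i<cq (mono (≺-asym q≺x))) }))

      above′ : ∀ {i} → c q < i → new (suc i) ≤ old i
      above′ {i} cq<i = small-mono (count-L≤L′ (λ x → c x ≟ i) (λ x → c′ x ≟ suc i)
        (λ { refl → ℕₚ.<-irrefl refl cq<i })
        (λ {x} → λ { refl → shifted x cq<i }))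
        where
        shifted : ∀ x → c q < c x → c′ x ≡ suc (c x)
        shifted x cq<cx with q ≺? x
        ... | yes _    = ℕₚ.+-comm (c x) 1
        ... | no  ¬q≺x = contradiction (mono ¬q≺x) (ℕₚ.<⇒≱ cq<cx)

      -- The keys of the split section below `q` all keep the index `c q`, so a small left part
      -- forces `q` to have low rank; those above `q` move to `suc (c q)` and force the mirror
      -- image.
      left : new (c q) ≤ lowInSection T c L q
      left = small-mono (ℕₚ.≤-trans
        (ℕₚ.≤-reflexive (count-filter (_≺? q) (λ x → c x ≟ c q) L))
        (count-L≤L′ _ (λ x → c′ x ≟ c q) (λ (_ , q≺q) → irrefl Eq.refl q≺q)
          (λ (eq , x≺q) → trans (addSeparator-below c (≺-asym x≺q)) eq)))

      right : new (suc (c q)) ≤ highInSection T c L q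
      right = small-mono (ℕₚ.≤-trans
        (ℕₚ.≤-reflexive (count-filter (_≻? q) (λ x → c x ≟ c q) L))
        (count-L≤L′ _ (λ x → c′ x ≟ suc (c q)) (λ (_ , q≺q) → irrefl Eq.refl q≺q)
          (λ (eq , q≺x) → trans (addSeparator-above c q≺x) (cong suc eq))))

    -- Each of the `suc d` sections has at most `T` keys close to its lower end and at most `T`
    -- close to its upper end; by `smallSections-split` each such proximity costs at most one new
    -- small section.
    smallSections-sumPicks : ∀ T {c d} → Monotone c → (∀ x → c x ≤ d) → ∀ L → Distinct L →
      sumPicks L (λ q → smallSections T (addSeparator q c) (suc d)) ≤
      length L * smallSections T c d L + (suc d * T + suc d * T)
    smallSections-sumPicks T {c} {d} mono c≤d L distinct = begin
      sumPicks L (λ q → smallSections T (addSeparator q c) (suc d))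
        ≤⟨ sumPicks-mono L (smallSections-split T mono c≤d) ⟩
      sumPicks L (λ q _ → smallSections T c d L + (lowInSection T c L q + highInSection T c L q))
        ≡⟨ sumPicks-+ L _ _ ⟩
      sumPicks L (λ _ _ → smallSections T c d L) + sumPicks L (λ q _ → lowInSection T c L q + highInSection T c L q)
        ≡⟨ cong₂ _+_ (sumPicks-const L _)
             (trans (sumPicks-map L _) (sum-map-+ (lowInSection T c L) (highInSection T c L) L)) ⟩
      length L * smallSections T c d L + (sum (map (lowInSection T c L) L) + sum (map (highInSection T c L) L))
        ≤⟨ ℕₚ.+-monoʳ-≤ (length L * smallSections T c d L) (ℕₚ.+-mono-≤
             (low-rank-in-sections _≺?_ ≺-trans T c≤d L distinct)
             (low-rank-in-sections _≻?_ (λ x≻y y≻z → ≺-trans y≻z x≻y) T c≤d L (AllPairs.map swap-⊎ distinct))) ⟩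
      length L * smallSections T c d L + (suc d * T + suc d * T) ∎
      where
      open ℕₚ.≤-Reasoning

    -- With `d` separators present, the next one increases the mean by at most `2 (d + 1) T / n`.
    -- The last hypothesis makes this at most 1/2, and the inequality is doubled to avoid the
    -- fraction. The summand `k` in that hypothesis allows for the key that each separator removes
    -- from `L`.
    smallSections-sumPerms : ∀ T k n {c d L} → Monotone c → (∀ x → c x ≤ d) →
      length L ≡ n → Distinct L → 4 * ((d + k) * T) + k ≤ n →
      sumPerms n L (λ Y → 2 * smallSections T (λ x → c x + below (take k Y) x) (d + k) (drop k Y)) ≤
      n ! * (2 * smallSections T c d L + k)
    smallSections-sumPerms T zero n {c} {d} {L} mono c≤d eq distinct room = begin
      sumPerms n L (λ Y → 2 * smallSections T (λ x → c x + 0) (d + 0) Y)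
        ≡⟨ sumPerms-cong n eq (λ perm → cong (2 *_)
             (smallSections-cong T (λ x → ℕₚ.+-identityʳ (c x)) (ℕₚ.+-identityʳ d) (↭-sym perm))) ⟩
      sumPerms n L (λ Y → 2 * smallSections T c d L)
        ≡⟨ sumPerms-const n eq _ ⟩
      n ! * (2 * smallSections T c d L)
        ≡⟨ cong (n ! *_) (ℕₚ.+-identityʳ _) ⟨
      n ! * (2 * smallSections T c d L + 0) ∎
      where open ℕₚ.≤-Reasoning
    smallSections-sumPerms T (suc k) zero {d = d} _ _ _ _ room =
      contradiction (ℕₚ.m+n≤o⇒n≤o (4 * ((d + suc k) * T)) room) λ ()
    smallSections-sumPerms T (suc k) (suc n) {c} {d} {L} mono c≤d eq distinct room = begin
      sumPicks L (λ q L′ → sumPerms n L′ (λ Y →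
        2 * smallSections T (λ x → c x + below (q ∷ take k Y) x) (d + suc k) (drop k Y)))
        ≤⟨ sumPicks-mono L next ⟩
      sumPicks L (λ q L′ → n ! * (2 * smallSections T (addSeparator q c) (suc d) L′ + k))
        ≡⟨ sumPicks-* L (n !) _ ⟩
      n ! * sumPicks L (λ q L′ → 2 * smallSections T (addSeparator q c) (suc d) L′ + k)
        ≡⟨ cong (n ! *_) (trans (sumPicks-+ L _ _) (cong₂ _+_ (sumPicks-* L 2 _) (trans (sumPicks-const L k) (cong (_* k) eq)))) ⟩
      n ! * (2 * sumPicks L (λ q → smallSections T (addSeparator q c) (suc d)) + suc n * k)
        ≤⟨ ℕₚ.*-monoʳ-≤ (n !) (ℕₚ.+-monoˡ-≤ (suc n * k) (ℕₚ.*-monoʳ-≤ 2 (smallSections-sumPicks T mono c≤d L distinct))) ⟩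
      n ! * (2 * (length L * S + (suc d * T + suc d * T)) + suc n * k)
        ≡⟨ cong (λ l → n ! * (2 * (l * S + (suc d * T + suc d * T)) + suc n * k)) eq ⟩
      n ! * (2 * (suc n * S + (suc d * T + suc d * T)) + suc n * k)
        ≡⟨ rearrange₁ (n !) n S (suc d * T) k ⟩
      n ! * (suc n * (2 * S + k) + 4 * (suc d * T))
        ≤⟨ ℕₚ.*-monoʳ-≤ (n !) (ℕₚ.+-monoʳ-≤ (suc n * (2 * S + k)) room₁) ⟩
      n ! * (suc n * (2 * S + k) + suc n)
        ≡⟨ rearrange₂ (n !) n S k ⟩
      suc n ! * (2 * S + suc k) ∎
      where
      open ℕₚ.≤-Reasoning
      S : ℕ
      S = smallSections T c d L

      room₁ : 4 * (suc d * T) ≤ suc n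
      room₁ = ℕₚ.≤-trans (ℕₚ.*-monoʳ-≤ 4 (ℕₚ.*-monoˡ-≤ T
        (ℕₚ.≤-trans (s≤s (ℕₚ.m≤m+n d k)) (ℕₚ.≤-reflexive (sym (ℕₚ.+-suc d k))))))
        (ℕₚ.≤-trans (ℕₚ.m≤m+n _ (suc k)) room)

      room₂ : 4 * ((suc d + k) * T) + k ≤ n
      room₂ = ℕₚ.≤-pred (ℕₚ.≤-trans (ℕₚ.≤-reflexive (lemma d k T)) room)
        where
        lemma : ∀ d k T → suc (4 * ((suc d + k) * T) + k) ≡ 4 * ((d + suc k) * T) + suc k
        lemma = solve-∀

      rearrange₁ : ∀ f n s t k → f * (2 * (suc n * s + (t + t)) + suc n * k) ≡ f * (suc n * (2 * s + k) + 4 * t)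
      rearrange₁ = solve-∀
      rearrange₂ : ∀ f n s k → f * (suc n * (2 * s + k) + suc n) ≡ (f + n * f) * (2 * s + suc k)
      rearrange₂ = solve-∀

      next : ∀ {q L′} → Pick q L′ L → sumPerms n L′ (λ Y →
        2 * smallSections T (λ x → c x + below (q ∷ take k Y) x) (d + suc k) (drop k Y))
        ≤ n ! * (2 * smallSections T (addSeparator q c) (suc d) L′ + k)
      next {q} {L′} pick = ℕₚ.≤-trans
        (ℕₚ.≤-reflexive (sumPerms-cong n (Pick-length pick eq) (λ {Y} _ → cong (2 *_)
          (smallSections-cong T
            (λ x → trans (cong (c x +_) (count-∷ (_≺? x) q (take k Y))) (sym (ℕₚ.+-assoc (c x) (𝟙 (q ≺? x)) _)))
            (ℕₚ.+-suc d k) (↭-refl {x = drop k Y})))))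
        (smallSections-sumPerms T k n (addSeparator-monotone c mono) (addSeparator-≤ c c≤d)
          (Pick-length pick eq) (Pick-AllPairs pick distinct) room₂)

-- Ceilings, fractions and the fan-out

module FanOutBounds where

  open import Data.Integer.Base using (+_)
  open import Data.Nat.Base using (_+_; _*_; _∸_; _≤_; _<_)

  -- `ℚ.ceiling r` is minus the floor of `- r`, hence this quotient of a negative numerator, whose
  -- definition branches on the remainder. The two inequalities identify `k` as the ceiling of
  -- `suc n / d`.
  neg-/ℕ : ∀ n d-1 → let d = suc d-1 in
    ∃ λ k → ℤ.- (-[1+ n ] ℤ./ℕ d) ≡ + k × (k ∸ 1) * d < suc n × suc n ≤ k * d
  neg-/ℕ n d-1 with suc n ℕ.% suc d-1 in eq
  ... | zero  = k , ℤₚ.neg-involutive (+ k) , lt k n≡k*d , ℕₚ.≤-reflexive n≡k*d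
    where
    k : ℕ
    k = suc n ℕ./ suc d-1
    n≡k*d : suc n ≡ k * suc d-1
    n≡k*d = trans (ℕDivMod.m≡m%n+[m/n]*n (suc n) (suc d-1)) (cong (_+ k * suc d-1) eq)
    lt : ∀ k → suc n ≡ k * suc d-1 → (k ∸ 1) * suc d-1 < suc n
    lt (suc k) e = ℕₚ.≤-trans (s≤s (ℕₚ.m≤n+m (k * suc d-1) d-1)) (ℕₚ.≤-reflexive (sym e))
  ... | suc m = suc k , refl , lt , le
    where
    k : ℕ
    k = suc n ℕ./ suc d-1
    n≡ : suc n ≡ suc m + k * suc d-1
    n≡ = trans (ℕDivMod.m≡m%n+[m/n]*n (suc n) (suc d-1)) (cong (_+ k * suc d-1) eq)
    lt : k * suc d-1 < suc n
    lt = ℕₚ.≤-trans (s≤s (ℕₚ.m≤n+m (k * suc d-1) m)) (ℕₚ.≤-reflexive (sym n≡))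
    le : suc n ≤ suc k * suc d-1
    le = ℕₚ.≤-trans (ℕₚ.≤-reflexive n≡) (ℕₚ.+-monoˡ-≤ (k * suc d-1)
      (ℕₚ.≤-trans (ℕₚ.≤-reflexive (sym eq)) (ℕₚ.<⇒≤ (ℕDivMod.m%n<n (suc n) (suc d-1)))))

  ceiling-ratio : ∀ r {x y} .{{_ : ℕ.NonZero y}} → Positive r → ↥ r ℤ.* + y ≡ + x ℤ.* ↧ r →
    ∃ λ k → ℚ.ceiling r ≡ + k × (k ∸ 1) * y < x × x ≤ k * y
  ceiling-ratio (mkℚ +[1+ n ] d-1 _) {x} {y} _ eq with neg-/ℕ n d-1
  ... | k , ceil , lower , upper =
    k , trans (cong ℤ.-_ (ℤDivMod.div-pos-is-/ℕ -[1+ n ] d)) ceil ,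
    ℕₚ.*-cancelʳ-< d _ _ (begin-strict
      (k ∸ 1) * y * d  ≡⟨ *-swapʳ (k ∸ 1) y d ⟩
      (k ∸ 1) * d * y  <⟨ ℕₚ.*-monoˡ-< y lower ⟩
      suc n * y        ≡⟨ n*y≡x*d ⟩
      x * d            ∎) ,
    ℕₚ.*-cancelʳ-≤ _ _ d (begin
      x * d            ≡⟨ n*y≡x*d ⟨
      suc n * y        ≤⟨ ℕₚ.*-monoˡ-≤ y upper ⟩
      k * d * y        ≡⟨ *-swapʳ k d y ⟩
      k * y * d        ∎)
    where
    open ℕₚ.≤-Reasoning
    d : ℕ
    d = suc d-1
    n*y≡x*d : suc n * y ≡ x * d
    n*y≡x*d = ℤₚ.+-injective (trans (ℤₚ.pos-* (suc n) y) (trans eq (sym (ℤₚ.pos-* x d))))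

  toℚᵘ-/ : ∀ i n → toℚᵘ (i / suc n) ℚᵘ.≃ mkℚᵘ i n
  toℚᵘ-/ i n = ℚₚ.toℚᵘ-fromℚᵘ (mkℚᵘ i n)

  /-cross : ∀ i n .{{_ : ℕ.NonZero n}} → ↥ (i / n) ℤ.* + n ≡ i ℤ.* ↧ (i / n)
  /-cross i (suc n) = go (i / suc n) (toℚᵘ-/ i n)
    where
    go : ∀ r → toℚᵘ r ℚᵘ.≃ mkℚᵘ i n → ↥ r ℤ.* + suc n ≡ i ℤ.* ↧ r
    go record{} (*≡* eq) = eq

  /≤/ : ∀ m n k l .{{_ : ℕ.NonZero k}} .{{_ : ℕ.NonZero l}} → m * l ≤ n * k → + m / k ℚ.≤ + n / l
  /≤/ m n (suc k) (suc l) le = ℚₚ.toℚᵘ-cancel-≤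
    (ℚᵘₚ.≤-respˡ-≃ (ℚᵘₚ.≃-sym (toℚᵘ-/ (+ m) k))
    (ℚᵘₚ.≤-respʳ-≃ (ℚᵘₚ.≃-sym (toℚᵘ-/ (+ n) l))
    (*≤* (ℤₚ.≤-trans (ℤₚ.≤-reflexive (sym (ℤₚ.pos-* m (suc l))))
         (ℤₚ.≤-trans (ℤ.+≤+ le) (ℤₚ.≤-reflexive (ℤₚ.pos-* n (suc k))))))))

  numerator : ℚ → ℕ
  numerator ε = ℤ.∣ ↥ ε ∣

  numerator>0 : ∀ ε .{{_ : Positive ε}} → 0 < numerator ε
  numerator>0 (mkℚ +[1+ _ ] _ _) = s≤s z≤n

  *-/ : ∀ ε .{{_ : Positive ε}} m n .{{_ : ℕ.NonZero n}} .{{_ : ℕ.NonZero (↧ₙ ε * n)}} →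
    ε ℚ.* (+ m / n) ≡ + (numerator ε * m) / (↧ₙ ε * n)
  *-/ ε@(mkℚ +[1+ p ] q _) m (suc n) = ℚₚ.toℚᵘ-injective (ℚᵘₚ.≃-trans
    (ℚₚ.toℚᵘ-homo-* ε (+ m / suc n))
    (ℚᵘₚ.≃-trans (ℚᵘₚ.*-congˡ {toℚᵘ ε} (toℚᵘ-/ (+ m) n))
    (ℚᵘₚ.≃-trans (ℚᵘₚ.≃-reflexive (cong (λ i → mkℚᵘ i _) (sym (ℤₚ.pos-* (suc p) m))))
    (ℚᵘₚ.≃-sym (toℚᵘ-/ (+ (suc p * m)) _)))))

  numerator≤denominator : ∀ ε .{{_ : Positive ε}} → ε ℚ.≤ ½ → numerator ε ≤ ↧ₙ ε
  numerator≤denominator (mkℚ +[1+ p ] q _) (ℚ.*≤* le) = ℕₚ.≤-trans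
    (ℕₚ.m≤m*n (suc p) 2) (ℕₚ.≤-trans (ℤₚ.drop‿+≤+ le) (ℕₚ.≤-reflexive (ℕₚ.+-identityʳ (suc q))))

  module FanOut (α : ℕ) .{{_ : ℕ.NonZero α}} (ε : ℚ) .{{ε>0 : Positive ε}} where

    open Parameters α ε

    w : ℕ
    w = ↧ₙ ε * α

    private instance
      108α≢0 : ℕ.NonZero (108 * α)
      108α≢0 = ℕₚ.m*n≢0 108 α
      ε≢0 : ℚ.NonZero ε
      ε≢0 = ℚₚ.pos⇒nonZero ε
      ρ≢0 : ℚ.NonZero ρ
      ρ≢0 = ℚₚ.pos⇒nonZero ρ {{ρ-positive}}

    [n/m]*m : ∀ n m .{{_ : ℕ.NonZero m}} → (n / m) ℚ.* (+ m / 1) ≡ n / 1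
    [n/m]*m n (suc m) = ℚₚ.toℚᵘ-injective (ℚᵘₚ.≃-trans
      (ℚₚ.toℚᵘ-homo-* (n / suc m) (+ suc m / 1))
      (ℚᵘₚ.≃-trans (ℚᵘₚ.*-cong (toℚᵘ-/ n m) (toℚᵘ-/ (+ suc m) 0))
      (ℚᵘₚ.≃-trans (*≡* (trans (ℤₚ.*-identityʳ _) (cong (λ k → n ℤ.* + suc k) (sym (ℕₚ.*-identityʳ m)))))
      (ℚᵘₚ.≃-sym (toℚᵘ-/ n 0)))))

    ÷ρ : ∀ n → (n / 1) ÷ ρ ≡ ε ℚ.* (n / (108 * α))
    ÷ρ n = begin
      (n / 1) ℚ.* 1/ ρ                              ≡⟨ cong (ℚ._* 1/ ρ) (sym X*ρ) ⟩
      (X ℚ.* ρ) ℚ.* 1/ ρ                            ≡⟨ ℚₚ.*-assoc X ρ (1/ ρ) ⟩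
      X ℚ.* (ρ ℚ.* 1/ ρ)                            ≡⟨ cong (X ℚ.*_) (ℚₚ.*-inverseʳ ρ) ⟩
      X ℚ.* 1ℚ                                      ≡⟨ ℚₚ.*-identityʳ X ⟩
      X                                             ∎
      where
      open ≡-Reasoning
      Y X : ℚ
      Y = n / (108 * α)
      X = ε ℚ.* Y
      X*ρ : X ℚ.* ρ ≡ n / 1
      X*ρ = begin
        (ε ℚ.* Y) ℚ.* (M ℚ.* 1/ ε)   ≡⟨ cong (ℚ._* (M ℚ.* 1/ ε)) (ℚₚ.*-comm ε Y) ⟩
        (Y ℚ.* ε) ℚ.* (M ℚ.* 1/ ε)   ≡⟨ ℚₚ.*-assoc Y ε _ ⟩
        Y ℚ.* (ε ℚ.* (M ℚ.* 1/ ε))   ≡⟨ cong (λ t → Y ℚ.* (ε ℚ.* t)) (ℚₚ.*-comm M (1/ ε)) ⟩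
        Y ℚ.* (ε ℚ.* (1/ ε ℚ.* M))   ≡⟨ cong (Y ℚ.*_) (sym (ℚₚ.*-assoc ε (1/ ε) M)) ⟩
        Y ℚ.* ((ε ℚ.* 1/ ε) ℚ.* M)   ≡⟨ cong (λ t → Y ℚ.* (t ℚ.* M)) (ℚₚ.*-inverseʳ ε) ⟩
        Y ℚ.* (1ℚ ℚ.* M)             ≡⟨ cong (Y ℚ.*_) (ℚₚ.*-identityˡ M) ⟩
        Y ℚ.* M                      ≡⟨ [n/m]*m n (108 * α) ⟩
        n / 1                        ∎
        where
        M : ℚ
        M = + (108 * α) / 1

    ratio : ∀ m → let r = (+ m / 1) ÷ ρ in ↥ r ℤ.* + (108 * w) ≡ + (numerator ε * m) ℤ.* ↧ r
    ratio m = subst (λ r → ↥ r ℤ.* + (108 * w) ≡ + (numerator ε * m) ℤ.* ↧ r)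
      (sym (trans (÷ρ (+ m)) (*-/ ε m (108 * α))))
      (trans (cong (λ d → ↥ X ℤ.* + d) (*-swapˡ 108 (↧ₙ ε) α)) (/-cross (+ (numerator ε * m)) (↧ₙ ε * (108 * α))))
      where
      instance
        q*108α≢0 : ℕ.NonZero (↧ₙ ε * (108 * α))
        q*108α≢0 = ℕₚ.m*n≢0 (↧ₙ ε) (108 * α)
      X : ℚ
      X = + (numerator ε * m) / (↧ₙ ε * (108 * α))

    private
      clamp : ℤ → ℕ
      clamp i = ℤ.∣ + (α + 1) ℤ.⊓ (+ 1 ℤ.⊔ i) ∣

      clamp-bounds : ∀ i → 1 ≤ clamp i × clamp i ≤ α + 1
      clamp-bounds (+ k)    = ℕₚ.⊓-glb (ℕₚ.m≤n+m 1 α) (ℕₚ.m≤m⊔n 1 k) , ℕₚ.m⊓n≤m (α + 1) (1 ℕ.⊔ k)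
      clamp-bounds -[1+ k ] = ℕₚ.⊓-glb (ℕₚ.m≤n+m 1 α) ℕₚ.≤-refl , ℕₚ.m⊓n≤m (α + 1) 1

    1≤δ : ∀ s → 1 ≤ δ s
    1≤δ s = proj₁ (clamp-bounds (ℚ.ceiling (((+ s ℤ.- + α) / 1) ÷ ρ)))

    δ≤α+1 : ∀ s → δ s ≤ α + 1
    δ≤α+1 s = proj₂ (clamp-bounds (ℚ.ceiling (((+ s ℤ.- + α) / 1) ÷ ρ)))

    fanOut : ∀ m .{{_ : ℕ.NonZero m}} → ∃ λ k → δ (α + m) ≡ (α + 1) ℕ.⊓ (1 ℕ.⊔ k)
      × (k ∸ 1) * (108 * w) < numerator ε * m × numerator ε * m ≤ k * (108 * w)
    fanOut m =
      let k , ceil , bounds = ceiling-ratio ((+ m / 1) ÷ ρ) {numerator ε * m} {108 * w} r>0 (ratio m)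
      in k , trans (cong (λ i → clamp (ℚ.ceiling ((i / 1) ÷ ρ))) s-α≡m) (cong clamp ceil) , bounds
      where
      s-α≡m : + (α + m) ℤ.- + α ≡ + m
      s-α≡m = trans (ℤₚ.[+m]-[+n]≡m⊖n (α + m) α)
        (trans (ℤₚ.⊖-≥ (ℕₚ.m≤m+n α m)) (cong +_ (ℕₚ.m+n∸m≡n α m)))

      r>0 : Positive ((+ m / 1) ÷ ρ)
      r>0 = ℚₚ.pos*pos⇒pos (+ m / 1) {{ℚₚ.normalize-pos m 1}} (1/ ρ) {{ℚₚ.1/pos⇒pos ρ {{ρ-positive}}}}

      instance
        108w≢0 : ℕ.NonZero (108 * w)
        108w≢0 = ℕₚ.m*n≢0 108 w {{_}} {{ℕₚ.m*n≢0 (↧ₙ ε) α}}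

    -- The cap `α + 1` can only lower `δ`, and the floor 1 is absorbed by truncated subtraction, so
    -- the lower inequality for the ceiling survives.
    separators-bound : ∀ m .{{_ : ℕ.NonZero m}} → (δ (α + m) ∸ 1) * (108 * w) < numerator ε * m
    separators-bound m = let k , eq , lower , _ = fanOut m in
      ℕₚ.≤-<-trans (ℕₚ.*-monoˡ-≤ (108 * w) (bound k eq)) lower
      where
      bound : ∀ k {d} → d ≡ (α + 1) ℕ.⊓ (1 ℕ.⊔ k) → d ∸ 1 ≤ k ∸ 1
      bound zero    refl = ℕₚ.∸-monoˡ-≤ 1 (ℕₚ.m⊓n≤n (α + 1) 1)
      bound (suc k) refl = ℕₚ.∸-monoˡ-≤ 1 (ℕₚ.m⊓n≤n (α + 1) (suc k))

    δ≡1 : ∀ m .{{_ : ℕ.NonZero m}} → numerator ε * m ≤ 108 * w → δ (α + m) ≡ 1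
    δ≡1 m le = go (δ (α + m)) (1≤δ (α + m)) (separators-bound m)
      where
      go : ∀ d → 1 ≤ d → (d ∸ 1) * (108 * w) < numerator ε * m → d ≡ 1
      go 1             _ _  = refl
      go (suc (suc d)) _ lt = contradiction
        (ℕₚ.≤-trans (ℕₚ.≤-trans (s≤s (ℕₚ.m≤m+n (108 * w) (d * (108 * w)))) lt) le) (ℕₚ.<-irrefl refl)

    -- As `α` is positive, the cap `α + 1` is at least 2 and does not cut a ceiling above 1 down to
    -- 1.
    1<δ : ∀ m .{{_ : ℕ.NonZero m}} → 108 * w < numerator ε * m → 1 < δ (α + m)
    1<δ m gt = let k , eq , _ , upper = fanOut m in
      ℕₚ.≤-trans (ℕₚ.⊓-glb (ℕₚ.+-monoˡ-≤ 1 (ℕ.>-nonZero⁻¹ α)) (ℕₚ.≤-trans (1<k k upper) (ℕₚ.m≤n⊔m 1 k)))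
        (ℕₚ.≤-reflexive (sym eq))
      where
      1<k : ∀ k → numerator ε * m ≤ k * (108 * w) → 1 < k
      1<k zero          le = contradiction (ℕₚ.≤-trans gt le) λ ()
      1<k (suc zero)    le = contradiction (ℕₚ.<-≤-trans gt le) (ℕₚ.<-irrefl (sym (ℕₚ.+-identityʳ _)))
      1<k (suc (suc k)) le = s≤s (s≤s z≤n)

-- Non-full blocks along the recursive construction

module NonFullBlocks where

  open import Data.Nat.Base using (_+_; _*_; _∸_; _!; _≤_; _<_)
  open RandomOrders
  open SmallSections
  open FanOutBounds

  module NonFull {a ℓ₁ ℓ₂} (U : StrictTotalOrder a ℓ₁ ℓ₂)
    (α : ℕ) .{{_ : ℕ.NonZero α}} (ε : ℚ) .{{_ : Positive ε}} where

    open StrictTotalOrder U using (Carrier)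
    open RBST U α ε hiding (T)
    open Parameters α ε using (δ)
    open FanOut α ε
    open Sections U using (below; Distinct; smallSections; smallSections-sumPerms)

    nonFull : List Carrier → ℕ
    nonFull Y = maybe′ nonFullBlocks 0 (tree Y)

    nonFull-forest : (f : List Carrier → Maybe (Tree Carrier)) → ∀ Ys →
      count (λ keys → ¬? (full? keys)) (forestBlocks (mapMaybe f Ys)) ≡ sum (map (maybe′ nonFullBlocks 0 ∘ f) Ys)
    nonFull-forest f []       = refl
    nonFull-forest f (Y ∷ Ys) with f Y
    ... | nothing = nonFull-forest f Ys
    ... | just t  = trans
      (cong length (filter-++ (λ keys → ¬? (full? keys)) (blocks t) (forestBlocks (mapMaybe f Ys))))
      (trans (length-++ (filter (λ keys → ¬? (full? keys)) (blocks t)))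
             (cong (nonFullBlocks t +_) (nonFull-forest f Ys)))

    nonFull-unfold : ∀ y ys → let Y = y ∷ ys in
      nonFull Y ≡ 𝟙 (¬? (full? (take α Y))) + sumUpTo (δ (length Y)) (nonFull ∘ section Y)
    nonFull-unfold y ys = begin
      nonFull Y
        ≡⟨ cong (maybe′ nonFullBlocks 0) (tree-unfold y ys) ⟩
      count (λ keys → ¬? (full? keys)) (take α Y ∷ forestBlocks (mapMaybe tree (sections Y)))
        ≡⟨ count-∷ (λ keys → ¬? (full? keys)) (take α Y) _ ⟩
      𝟙 (¬? (full? (take α Y))) + count (λ keys → ¬? (full? keys)) (forestBlocks (mapMaybe tree (sections Y)))
        ≡⟨ cong (𝟙 (¬? (full? (take α Y))) +_) (nonFull-forest tree (sections Y)) ⟩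
      𝟙 (¬? (full? (take α Y))) + sum (map nonFull (sections Y))
        ≡⟨ cong (λ Zs → 𝟙 (¬? (full? (take α Y))) + sum Zs)
             (trans (cong (map nonFull) (map-upTo (section Y) (δ (length Y))))
                    (map-applyUpTo (section Y) nonFull (δ (length Y)))) ⟩
      𝟙 (¬? (full? (take α Y))) + sumUpTo (δ (length Y)) (nonFull ∘ section Y) ∎
      where
      open ≡-Reasoning
      Y : List Carrier
      Y = y ∷ ys

    nonFull-leaf : ∀ Y → length Y ≤ α → nonFull Y ≤ 1
    nonFull-leaf []       _  = z≤n
    nonFull-leaf Y@(y ∷ ys) le = begin
      nonFull Y
        ≡⟨ nonFull-unfold y ys ⟩
      𝟙 (¬? (full? (take α Y))) + sumUpTo (δ (length Y)) (nonFull ∘ section Y)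
        ≡⟨ cong (𝟙 (¬? (full? (take α Y))) +_)
             (trans (sumUpTo-cong (δ (length Y)) λ i → cong nonFull (section≡[] i))
                    (trans (sumUpTo-const (δ (length Y)) 0) (ℕₚ.*-zeroʳ (δ (length Y))))) ⟩
      𝟙 (¬? (full? (take α Y))) + 0
        ≤⟨ ℕₚ.≤-trans (ℕₚ.≤-reflexive (ℕₚ.+-identityʳ _)) (𝟙≤1 (¬? (full? (take α Y)))) ⟩
      1 ∎
      where
      open ℕₚ.≤-Reasoning
      empty : ∀ (Z : List Carrier) → length Z ≡ 0 → Z ≡ []
      empty [] _ = refl
      section≡[] : ∀ i → section Y i ≡ []
      section≡[] i = cong (filter (λ x → sectionIndex Y x ≟ i))
        (empty (drop α Y) (trans (length-drop α Y) (ℕₚ.m≤n⇒m∸n≡0 le)))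

    nonFull-inner : ∀ m .{{_ : ℕ.NonZero m}} Y → length Y ≡ α + m →
      nonFull Y ≡ sumUpTo (δ (length Y)) (nonFull ∘ section Y)
    nonFull-inner m Y eq = go Y eq
      where
      go : ∀ Y → length Y ≡ α + m → nonFull Y ≡ sumUpTo (δ (length Y)) (nonFull ∘ section Y)
      go []         eq = contradiction (ℕₚ.m+n≡0⇒n≡0 α (sym eq)) (ℕ.≢-nonZero⁻¹ m)
      go Y@(y ∷ ys) eq = trans (nonFull-unfold y ys)
        (cong (_+ sumUpTo (δ (length Y)) (nonFull ∘ section Y))
          (𝟙-no (¬? (full? (take α Y))) (λ ¬full → ¬full
            (trans (length-take α Y) (trans (cong (α ℕ.⊓_) eq) (ℕₚ.m≤n⇒m⊓n≡m (ℕₚ.m≤m+n α m)))))))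

    length-section : ∀ Y i → length (section Y i) ≤ length Y ∸ α
    length-section Y i = ℕₚ.≤-trans (length-filter (λ x → sectionIndex Y x ≟ i) (drop α Y))
      (ℕₚ.≤-reflexive (length-drop α Y))

    -- The last premise passes to the only section because that section is shorter than `Y`. The
    -- bound `n` makes the recursion structural.
    nonFull-chain : ∀ n Y → length Y ≤ n → numerator ε * (length Y ∸ α) ≤ 108 * w → nonFull Y ≤ 1
    nonFull-chain zero    Y le few = nonFull-leaf Y (ℕₚ.≤-trans le z≤n)
    nonFull-chain (suc n) Y le few = go (length Y ∸ α) refl
      where
      go : ∀ m → length Y ∸ α ≡ m → nonFull Y ≤ 1
      go zero      eq = nonFull-leaf Y (ℕₚ.m∸n≡0⇒m≤n eq)
      go m@(suc _) eq = begin
        nonFull Y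
          ≡⟨ nonFull-inner m Y Y≡ ⟩
        sumUpTo (δ (length Y)) (nonFull ∘ section Y)
          ≡⟨ cong (λ d → sumUpTo d (nonFull ∘ section Y))
               (trans (cong δ Y≡) (δ≡1 m (subst (λ k → numerator ε * k ≤ 108 * w) eq few))) ⟩
        nonFull (section Y 0) + 0
          ≡⟨ ℕₚ.+-identityʳ _ ⟩
        nonFull (section Y 0)
          ≤⟨ nonFull-chain n (section Y 0)
               (ℕₚ.≤-trans Z≤m (ℕₚ.≤-pred (ℕₚ.≤-trans m<Y le)))
               (ℕₚ.≤-trans (ℕₚ.*-monoʳ-≤ (numerator ε) (ℕₚ.≤-trans (ℕₚ.m∸n≤m _ α) (length-section Y 0))) few) ⟩
        1 ∎
        where
        open ℕₚ.≤-Reasoning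
        α≤Y : α ≤ length Y
        α≤Y = ℕₚ.<⇒≤ (ℕₚ.m∸n≢0⇒n<m {length Y} {α} (λ z → contradiction (trans (sym eq) z) λ ()))
        Y≡ : length Y ≡ α + m
        Y≡ = trans (sym (ℕₚ.m+[n∸m]≡n α≤Y)) (cong (α +_) eq)
        Z≤m : length (section Y 0) ≤ m
        Z≤m = ℕₚ.≤-trans (length-section Y 0) (ℕₚ.≤-reflexive eq)
        m<Y : m < length Y
        m<Y = ℕₚ.≤-trans (ℕₚ.+-monoˡ-≤ m (ℕ.>-nonZero⁻¹ α)) (ℕₚ.≤-reflexive (sym Y≡))

    -- The potential and the induction on the number of keys

    private instance
      p≢0 : ℕ.NonZero (numerator ε)
      p≢0 = ℕ.>-nonZero (numerator>0 ε)

    -- With p = numerator ε the potential p s − w + 2 w [s < K] dominates w e_s; the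
    -- term − w is moved to the other side. K is least such that p K > 2 w.
    K : ℕ
    K = suc (2 * w ℕ./ numerator ε)

    2w≤pK : 2 * w ≤ numerator ε * K
    2w≤pK = begin
      2 * w                                                  ≡⟨ ℕDivMod.m≡m%n+[m/n]*n (2 * w) (numerator ε) ⟩
      2 * w ℕ.% numerator ε + 2 * w ℕ./ numerator ε * numerator ε
        ≤⟨ ℕₚ.+-monoˡ-≤ _ (ℕₚ.<⇒≤ (ℕDivMod.m%n<n (2 * w) (numerator ε))) ⟩
      K * numerator ε                                        ≡⟨ ℕₚ.*-comm K (numerator ε) ⟩
      numerator ε * K                                        ∎
      where open ℕₚ.≤-Reasoning

    pK≤p+2w : numerator ε * K ≤ numerator ε + 2 * w
    pK≤p+2w = begin
      numerator ε * K                                    ≡⟨ ℕₚ.*-comm (numerator ε) K ⟩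
      numerator ε + 2 * w ℕ./ numerator ε * numerator ε  ≤⟨ ℕₚ.+-monoʳ-≤ (numerator ε) (ℕDivMod.m/n*n≤m (2 * w) (numerator ε)) ⟩
      numerator ε + 2 * w                                ∎
      where open ℕₚ.≤-Reasoning

    potential : ℕ → ℕ
    potential s = numerator ε * s + 2 * w * 𝟙 (s ℕₚ.<? K)

    -- Below `K` the indicator supplies `2 w`; from `K` on the linear term does. A tree with at most
    -- one non-full block has cost at most `2 w`, so this settles it for every size.
    2w≤potential : ∀ s → 2 * w ≤ potential s
    2w≤potential s = go (s ℕₚ.<? K)
      where
      go : (s<?K : Dec (s < K)) → 2 * w ≤ numerator ε * s + 2 * w * 𝟙 s<?K
      go (yes _)   = ℕₚ.≤-trans (ℕₚ.≤-reflexive (sym (ℕₚ.*-identityʳ (2 * w)))) (ℕₚ.m≤n+m (2 * w * 1) (numerator ε * s))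
      go (no s≮K) = ℕₚ.≤-trans 2w≤pK
        (ℕₚ.≤-trans (ℕₚ.*-monoʳ-≤ (numerator ε) (ℕₚ.≮⇒≥ s≮K)) (ℕₚ.m≤m+n (numerator ε * s) (2 * w * 0)))

    cost : List Carrier → ℕ
    cost Y = w * nonFull Y + w

    -- The right-hand side has the same summand for every order; it is written as a sum so that both
    -- sides pass alike through `sumPerms-filter-mono`.
    Bounded : List Carrier → Set
    Bounded L = sumPerms (length L) L cost ≤ sumPerms (length L) L (potential ∘ length)

    module Inner (m : ℕ) .{{_ : ℕ.NonZero m}} (ε≤½ : numerator ε ≤ ↧ₙ ε)
      (many : 108 * w < numerator ε * m) where

      -- Drawing `D` separators leaves `drop D Y`, whereas the children are built from `drop α Y`.
      -- The keys in between are stored without separating and may all fall into one section, so a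
      -- child with fewer than `K` keys may come from a section with almost `K + α`; hence the
      -- threshold `T`.
      s D T : ℕ
      s = α + m
      D = δ s ∸ 1
      T = K + α

      δ≡1+D : δ s ≡ suc D
      δ≡1+D = sym (ℕₚ.m+[n∸m]≡n (1≤δ s))

      D≤α : D ≤ α
      D≤α = ℕₚ.≤-trans (ℕₚ.∸-monoˡ-≤ 1 (δ≤α+1 s)) (ℕₚ.≤-reflexive (ℕₚ.m+n∸n≡m α 1))

      1≤D : 1 ≤ D
      1≤D = ℕₚ.∸-monoˡ-≤ 1 (1<δ m many)

      -- 17 w ≤ 108 w leaves ample room for the constant 108 of ρ.
      room : 4 * (D * T) + D ≤ s
      room = ℕₚ.*-cancelˡ-≤ (numerator ε) (begin
        p * (4 * (D * (K + α)) + D)             ≡⟨ expand p D K α ⟩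
        D * (4 * (p * K) + 4 * (p * α) + p)     ≤⟨ ℕₚ.*-monoʳ-≤ D (ℕₚ.+-monoˡ-≤ p (ℕₚ.+-monoˡ-≤ (4 * (p * α)) (ℕₚ.*-monoʳ-≤ 4 pK≤p+2w))) ⟩
        D * (4 * (p + 2 * w) + 4 * (p * α) + p) ≡⟨ cong (D *_) (collect p w (p * α)) ⟩
        D * (8 * w + 5 * p + 4 * (p * α))       ≤⟨ ℕₚ.*-monoʳ-≤ D (ℕₚ.+-mono-≤ (ℕₚ.+-monoʳ-≤ (8 * w) (ℕₚ.*-monoʳ-≤ 5 p≤w)) (ℕₚ.*-monoʳ-≤ 4 pα≤w)) ⟩
        D * (8 * w + 5 * w + 4 * w)             ≤⟨ ℕₚ.*-monoʳ-≤ D (ℕₚ.≤-trans (ℕₚ.≤-reflexive (17w w)) (ℕₚ.*-monoˡ-≤ w 17≤108)) ⟩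
        D * (108 * w)                           ≤⟨ ℕₚ.<⇒≤ (separators-bound m) ⟩
        p * m                                   ≤⟨ ℕₚ.*-monoʳ-≤ p (ℕₚ.m≤n+m m α) ⟩
        p * s                                   ∎)
        where
        open ℕₚ.≤-Reasoning
        p : ℕ
        p = numerator ε
        pα≤w : p * α ≤ w
        pα≤w = ℕₚ.*-monoˡ-≤ α ε≤½
        p≤w : p ≤ w
        p≤w = ℕₚ.≤-trans (ℕₚ.m≤m*n p α) pα≤w
        17≤108 : 17 ≤ 108
        17≤108 = ℕₚ.m≤m+n 17 91
        expand : ∀ p D K α → p * (4 * (D * (K + α)) + D) ≡ D * (4 * (p * K) + 4 * (p * α) + p)
        expand = solve-∀
        collect : ∀ p w v → 4 * (p + 2 * w) + 4 * v + p ≡ 8 * w + 5 * p + 4 * v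
        collect = solve-∀
        17w : ∀ w → 8 * w + 5 * w + 4 * w ≡ 17 * w
        17w = solve-∀

      inSection : List Carrier → ℕ → List Carrier → List Carrier
      inSection S i = filter (λ x → below S x ≟ i)

      smallAmong : List Carrier → List Carrier → ℕ
      smallAmong S Z = smallSections T (below S) D Z

      -- Functions of the stored keys `P` and the remaining keys `R`, the form in which
      -- `sumPerms-take-drop` conditions on the root; the active separators are `take D P`.
      costs potentials : List Carrier → List Carrier → ℕ
      costs      P R = sumUpTo (suc D) (λ i → cost (inSection (take D P) i R))
      potentials P R = sumUpTo (suc D) (λ i → potential (length (inSection (take D P) i R)))

      take-D : ∀ (Y : List Carrier) → take D Y ≡ take D (take α Y)
      take-D Y = sym (trans (take-take D α Y) (cong (λ k → take k Y) (ℕₚ.m≤n⇒m⊓n≡m D≤α)))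

      -- The root is full and adds nothing. The `w` in `cost Y` and the extra `D * w` together give
      -- each of the `suc D` sections, empty ones included, its own `w`.
      cost-unfold : ∀ Y → length Y ≡ s → cost Y + D * w ≡ costs (take α Y) (drop α Y)
      cost-unfold Y eq = begin
        w * nonFull Y + w + D * w
          ≡⟨ ℕₚ.+-assoc (w * nonFull Y) w (D * w) ⟩
        w * nonFull Y + suc D * w
          ≡⟨ cong (λ k → w * k + suc D * w) (trans (nonFull-inner m Y eq)
               (trans (cong (λ d → sumUpTo d (nonFull ∘ section Y)) (trans (cong δ eq) δ≡1+D))
                      (sumUpTo-cong (suc D) section≡))) ⟩
        w * sumUpTo (suc D) inner + suc D * w
          ≡⟨ cong₂ _+_ (sym (sumUpTo-* (suc D) w inner)) (sym (sumUpTo-const (suc D) w)) ⟩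
        sumUpTo (suc D) (λ i → w * inner i) + sumUpTo (suc D) (λ _ → w)
          ≡⟨ sumUpTo-+ (suc D) (λ i → w * inner i) (λ _ → w) ⟨
        costs (take α Y) (drop α Y) ∎
        where
        open ≡-Reasoning
        inner : ℕ → ℕ
        inner i = nonFull (inSection (take D (take α Y)) i (drop α Y))
        section≡ : ∀ i → nonFull (section Y i) ≡ inner i
        -- `sectionIndex` and `below` agree by definition, so only the list of separators is
        -- rewritten.
        section≡ i = cong (λ S → nonFull (inSection S i (drop α Y)))
          (trans (cong (λ k → take (δ k ∸ 1) Y) eq) (take-D Y))

      potentials-bound : ∀ Y → length Y ≡ s →
        potentials (take α Y) (drop α Y) ≤ numerator ε * m + w * (2 * smallAmong (take D Y) (drop D Y))
      potentials-bound Y eq = begin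
        potentials (take α Y) (drop α Y)
          ≡⟨ cong (λ S → sumUpTo (suc D) (λ i → potential (length (inSection S i R)))) (sym (take-D Y)) ⟩
        sumUpTo (suc D) (λ i → numerator ε * size i + 2 * w * 𝟙 (size i ℕₚ.<? K))
          ≡⟨ trans (sumUpTo-+ (suc D) (λ i → numerator ε * size i) (λ i → 2 * w * 𝟙 (size i ℕₚ.<? K)))
               (cong₂ _+_ (sumUpTo-* (suc D) (numerator ε) size) (sumUpTo-* (suc D) (2 * w) (λ i → 𝟙 (size i ℕₚ.<? K)))) ⟩
        numerator ε * sumUpTo (suc D) size + 2 * w * sumUpTo (suc D) (λ i → 𝟙 (size i ℕₚ.<? K))
          ≡⟨ cong (λ k → numerator ε * k + 2 * w * sumUpTo (suc D) (λ i → 𝟙 (size i ℕₚ.<? K)))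
               (trans (count-fibres (below S) below<1+D R) |R|≡m) ⟩
        numerator ε * m + 2 * w * sumUpTo (suc D) (λ i → 𝟙 (size i ℕₚ.<? K))
          ≤⟨ ℕₚ.+-monoʳ-≤ (numerator ε * m) (ℕₚ.*-monoʳ-≤ (2 * w) (sumUpTo-mono (suc D) small)) ⟩
        numerator ε * m + 2 * w * smallAmong S (drop D Y)
          ≡⟨ cong (numerator ε * m +_) (swap-* w (smallAmong S (drop D Y))) ⟩
        numerator ε * m + w * (2 * smallAmong S (drop D Y)) ∎
        where
        open ℕₚ.≤-Reasoning
        S R : List Carrier
        S = take D Y
        R = drop α Y
        size : ℕ → ℕ
        size i = length (inSection S i R)
        swap-* : ∀ x y → 2 * x * y ≡ x * (2 * y)
        swap-* = solve-∀
        |R|≡m : length R ≡ m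
        |R|≡m = trans (length-drop α Y) (trans (cong (_∸ α) eq) (ℕₚ.m+n∸m≡n α m))
        below<1+D : ∀ x → below S x < suc D
        below<1+D x = s≤s (ℕₚ.≤-trans (length-filter _ S)
          (ℕₚ.≤-trans (ℕₚ.≤-reflexive (length-take D Y)) (ℕₚ.m⊓n≤m D (length Y))))
        small : ∀ i → 𝟙 (size i ℕₚ.<? K) ≤ 𝟙 (length (inSection S i (drop D Y)) ℕₚ.<? T)
        small i = 𝟙-mono (size i ℕₚ.<? K) (_ ℕₚ.<? T) (λ size<K → begin-strict
          length (inSection S i (drop D Y))
            ≤⟨ count-drop (λ x → below S x ≟ i) (α ∸ D) (drop D Y) ⟩
          α ∸ D + length (inSection S i (drop (α ∸ D) (drop D Y)))
            ≡⟨ cong (λ Z → α ∸ D + length (inSection S i Z))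
                 (trans (drop-drop D (α ∸ D) Y) (cong (λ k → drop k Y) (ℕₚ.m+[n∸m]≡n D≤α))) ⟩
          α ∸ D + size i
            <⟨ ℕₚ.+-mono-≤-< (ℕₚ.m∸n≤m α D) size<K ⟩
          α + K
            ≡⟨ ℕₚ.+-comm α K ⟩
          T ∎)

      -- The `D * w` added to distribute the cost over the sections equals the bound on what small
      -- sections cost on average, `2 w` times `D / 2`; the two cancel.
      sumPerms-inner : ∀ {L} → length L ≡ s → Distinct L →
        (∀ Z → length Z ≤ m → Distinct Z → Bounded Z) →
        sumPerms s L cost ≤ s ! * (numerator ε * m)
      sumPerms-inner {L} eq distinct bounded = ℕₚ.+-cancelʳ-≤ (s ! * (D * w)) _ _ (begin
        sumPerms s L cost + s ! * (D * w)
          ≡⟨ cong (sumPerms s L cost +_) (sumPerms-const s eq (D * w)) ⟨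
        sumPerms s L cost + sumPerms s L (λ _ → D * w)
          ≡⟨ sumPerms-+ s eq cost (λ _ → D * w) ⟨
        sumPerms s L (λ Y → cost Y + D * w)
          ≡⟨ sumPerms-cong s eq (λ {Y} perm → cost-unfold Y (len perm)) ⟩
        sumPerms s L (λ Y → costs (take α Y) (drop α Y))
          ≤⟨ sumPerms-take-drop α m eq distinct {costs} {potentials} costs≤potentials ⟩
        sumPerms s L (λ Y → potentials (take α Y) (drop α Y))
          ≤⟨ sumPerms-mono s eq (λ {Y} perm → potentials-bound Y (len perm)) ⟩
        sumPerms s L (λ Y → numerator ε * m + w * (2 * smallAmong (take D Y) (drop D Y)))
          ≡⟨ trans (sumPerms-+ s eq (λ _ → numerator ε * m) (λ Y → w * (2 * smallAmong (take D Y) (drop D Y))))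
               (cong₂ _+_ (sumPerms-const s eq (numerator ε * m)) (sumPerms-* s eq w (λ Y → 2 * smallAmong (take D Y) (drop D Y)))) ⟩
        s ! * (numerator ε * m) + w * sumPerms s L (λ Y → 2 * smallAmong (take D Y) (drop D Y))
          ≤⟨ ℕₚ.+-monoʳ-≤ (s ! * (numerator ε * m)) (ℕₚ.*-monoʳ-≤ w
               (smallSections-sumPerms T D s {λ _ → 0} {0} (λ _ → z≤n) (λ _ → z≤n) eq distinct room)) ⟩
        s ! * (numerator ε * m) + w * (s ! * (2 * smallSections T (λ _ → 0) 0 L + D))
          ≡⟨ cong (λ k → s ! * (numerator ε * m) + w * (s ! * (2 * k + D))) one-section ⟩
        s ! * (numerator ε * m) + w * (s ! * D)
          ≡⟨ cong (s ! * (numerator ε * m) +_) (rotate w (s !) D) ⟩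
        s ! * (numerator ε * m) + s ! * (D * w) ∎)
        where
        open ℕₚ.≤-Reasoning
        len : ∀ {Y} → L ↭ Y → length Y ≡ s
        len perm = trans (↭-length (↭-sym perm)) eq
        rotate : ∀ x y z → x * (y * z) ≡ y * (z * x)
        rotate = solve-∀
        -- Before any separator is drawn, the single section is all of `L`; by `room` and `1≤D` it
        -- has at least `T` keys, so the count starts at 0.
        one-section : smallSections T (λ _ → 0) 0 L ≡ 0
        one-section = cong (_+ 0) (𝟙-no (_ ℕₚ.<? T) (ℕₚ.≤⇒≯ (begin
          T                      ≤⟨ ℕₚ.m≤n*m T D {{ℕ.>-nonZero 1≤D}} ⟩
          D * T                  ≤⟨ ℕₚ.m≤n*m (D * T) 4 ⟩
          4 * (D * T)            ≤⟨ ℕₚ.m≤m+n _ D ⟩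
          4 * (D * T) + D        ≤⟨ room ⟩
          s                      ≡⟨ eq ⟨
          length L               ≡⟨ cong length (filter-all (λ _ → 0 ≟ 0) (All.universal (λ _ → refl) L)) ⟨
          count (λ _ → 0 ≟ 0) L  ∎)))
        costs≤potentials : ∀ P {R} → length R ≡ m → Distinct R →
          sumPerms m R (costs P) ≤ sumPerms m R (potentials P)
        costs≤potentials P {R} |R|≡m distinct-R = begin
          sumPerms m R (costs P)
            ≡⟨ sumPerms-sumUpTo m |R|≡m (suc D) (λ i → cost ∘ inSection (take D P) i) ⟩
          sumUpTo (suc D) (λ i → sumPerms m R (cost ∘ inSection (take D P) i))
            ≤⟨ sumUpTo-mono (suc D) (λ i → sumPerms-filter-mono (λ x → below (take D P) x ≟ i) m {R} |R|≡m
                 {cost} {potential ∘ length}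
                 (bounded (inSection (take D P) i R)
                   (ℕₚ.≤-trans (length-filter (λ x → below (take D P) x ≟ i) R) (ℕₚ.≤-reflexive |R|≡m))
                   (AllPairsₚ.filter⁺ _ distinct-R))) ⟩
          sumUpTo (suc D) (λ i → sumPerms m R (potential ∘ length ∘ inSection (take D P) i))
            ≡⟨ sumPerms-sumUpTo m |R|≡m (suc D) (λ i → potential ∘ length ∘ inSection (take D P) i) ⟨
          sumPerms m R (potentials P) ∎

    w*1+w : ∀ w → w * 1 + w ≡ 2 * w
    w*1+w = solve-∀

    module _ (ε≤½ : numerator ε ≤ ↧ₙ ε) where

      -- The bound `n` carries the mutual recursion with `sumPerms-large`, whose sections have
      -- length at most `n`. Small sizes are settled order by order, large ones only on average.
      sumPerms-potential : ∀ n L → length L ≤ n → Distinct L → Bounded L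

      sumPerms-large : ∀ n L → length L ≤ suc n → Distinct L → 108 * w < numerator ε * (length L ∸ α) →
        sumPerms (length L) L cost ≤ length L ! * (numerator ε * (length L ∸ α))
      sumPerms-large n L le distinct = go (length L ∸ α) refl
        where
        go : ∀ m → length L ∸ α ≡ m → 108 * w < numerator ε * m →
          sumPerms (length L) L cost ≤ length L ! * (numerator ε * m)
        go zero      _  many = contradiction (ℕₚ.≤-trans many (ℕₚ.≤-reflexive (ℕₚ.*-zeroʳ (numerator ε)))) λ ()
        go m@(suc _) eq many = subst (λ s → sumPerms s L cost ≤ s ! * (numerator ε * m)) (sym L≡)
          (Inner.sumPerms-inner m ε≤½ many L≡ distinct (λ Z Z≤m distinct-Z →
            sumPerms-potential n Z (ℕₚ.≤-trans Z≤m (ℕₚ.≤-pred (ℕₚ.≤-trans m<L le))) distinct-Z))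
          where
          L≡ : length L ≡ α + m
          L≡ = trans (sym (ℕₚ.m+[n∸m]≡n (ℕₚ.<⇒≤ (ℕₚ.m∸n≢0⇒n<m {length L} {α} (λ z → contradiction (trans (sym eq) z) λ ())))))
            (cong (α +_) eq)
          m<L : m < length L
          m<L = ℕₚ.≤-trans (ℕₚ.+-monoˡ-≤ m (ℕ.>-nonZero⁻¹ α)) (ℕₚ.≤-reflexive (sym L≡))

      sumPerms-potential zero    [] _ _ = begin
        w * 0 + w    ≡⟨ cong (_+ w) (ℕₚ.*-zeroʳ w) ⟩
        w            ≤⟨ ℕₚ.m≤m+n w (w + 0) ⟩
        2 * w        ≤⟨ 2w≤potential 0 ⟩
        potential 0  ∎
        where open ℕₚ.≤-Reasoning
      sumPerms-potential (suc n) L le distinct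
        with numerator ε * (length L ∸ α) ℕₚ.≤? 108 * w
      ... | yes few = sumPerms-mono (length L) refl (λ {Y} perm → begin
        w * nonFull Y + w    ≤⟨ ℕₚ.+-monoˡ-≤ w (ℕₚ.*-monoʳ-≤ w (nonFull-chain (length Y) Y ℕₚ.≤-refl
                                  (subst (λ s → numerator ε * (s ∸ α) ≤ 108 * w) (↭-length perm) few))) ⟩
        w * 1 + w            ≡⟨ w*1+w w ⟩
        2 * w                ≤⟨ 2w≤potential (length Y) ⟩
        potential (length Y) ∎)
        where open ℕₚ.≤-Reasoning
      ... | no many = begin
        sumPerms (length L) L cost
          ≤⟨ sumPerms-large n L le distinct (ℕₚ.≰⇒> many) ⟩
        length L ! * (numerator ε * (length L ∸ α))
          ≡⟨ sumPerms-const (length L) refl _ ⟨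
        sumPerms (length L) L (λ _ → numerator ε * (length L ∸ α))
          ≤⟨ sumPerms-mono (length L) refl (λ {Y} perm → ℕₚ.≤-trans
               (ℕₚ.*-monoʳ-≤ (numerator ε) (ℕₚ.≤-trans (ℕₚ.m∸n≤m (length L) α) (ℕₚ.≤-reflexive (↭-length perm))))
               (ℕₚ.m≤m+n (numerator ε * length Y) _)) ⟩
        sumPerms (length L) L (potential ∘ length) ∎
        where open ℕₚ.≤-Reasoning

      -- The two regimes of the induction become the two arguments of the maximum: `nonFull-chain`
      -- gives the constant 1, and `sumPerms-large` gives the linear bound after dropping the
      -- surplus `w` and `α`.
      sumPerms-nonFull : ∀ L → Distinct L → let n = length L in
        w * sumPerms n L nonFull ≤ n ! * (numerator ε * n) ⊎ sumPerms n L nonFull ≤ n !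
      sumPerms-nonFull L distinct with numerator ε * (length L ∸ α) ℕₚ.≤? 108 * w
      ... | yes few = inj₂ (begin
        sumPerms (length L) L nonFull
          ≤⟨ sumPerms-mono (length L) refl (λ {Y} perm → nonFull-chain (length Y) Y ℕₚ.≤-refl
               (subst (λ s → numerator ε * (s ∸ α) ≤ 108 * w) (↭-length perm) few)) ⟩
        sumPerms (length L) L (λ _ → 1)
          ≡⟨ sumPerms-const (length L) refl 1 ⟩
        length L ! * 1
          ≡⟨ ℕₚ.*-identityʳ _ ⟩
        length L ! ∎)
        where open ℕₚ.≤-Reasoning
      ... | no many = inj₁ (begin
        w * sumPerms (length L) L nonFull
          ≡⟨ sumPerms-* (length L) refl w nonFull ⟨
        sumPerms (length L) L (λ Y → w * nonFull Y)
          ≤⟨ sumPerms-mono (length L) refl (λ {Y} _ → ℕₚ.m≤m+n (w * nonFull Y) w) ⟩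
        sumPerms (length L) L cost
          ≤⟨ sumPerms-large (length L) L (ℕₚ.n≤1+n _) distinct (ℕₚ.≰⇒> many) ⟩
        length L ! * (numerator ε * (length L ∸ α))
          ≤⟨ ℕₚ.*-monoʳ-≤ (length L !) (ℕₚ.*-monoʳ-≤ (numerator ε) (ℕₚ.m∸n≤m (length L) α)) ⟩
        length L ! * (numerator ε * length L) ∎)
        where open ℕₚ.≤-Reasoning

-- Passage to the rational expectation

open RandomOrders
open SmallSections
open FanOutBounds
open NonFullBlocks
open import Data.Integer.Base using (+_)
open import Data.Nat.Base using (_!)
open import Data.Rational.Base using (_*_; _⊔_; _≤_)

tabulate-distinct : ∀ {a ℓ₁ ℓ₂} (U : StrictTotalOrder a ℓ₁ ℓ₂) {n} (key : Fin n → StrictTotalOrder.Carrier U) →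
  Injective _≡_ (StrictTotalOrder._≈_ U) key → Sections.Distinct U (tabulate key)
tabulate-distinct U key injective = AllPairsₚ.tabulate⁺ comparable
  where
  comparable : ∀ {i j} → i ≢ j → _
  comparable {i} {j} i≢j with StrictTotalOrder.compare U (key i) (key j)
  ... | tri< lt _ _ = inj₁ lt
  ... | tri≈ _ eq _ = contradiction (injective eq) i≢j
  ... | tri> _ _ gt = inj₂ gt

theorem7 : ∀ {a ℓ₁ ℓ₂} (U : StrictTotalOrder a ℓ₁ ℓ₂)
    (α : ℕ) .{{_ : ℕ.NonZero α}} (ε : ℚ) .{{_ : Positive ε}} →
    ε ≤ ½ →
    (∃[ m ] Parameters.β α ε ≡ m / 1) →
    ∀ (n : ℕ) (key : Fin n → StrictTotalOrder.Carrier U) →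
    Injective _≡_ (StrictTotalOrder._≈_ U) key →
    𝔼 n (RBST.E U α ε key) ≤ (ε * (+ n / α)) ⊔ 1ℚ
theorem7 U α ε ε≤½ _ n key injective = conclude
  (subst (λ k → w ℕ.* sumPerms k L nonFull ℕ.≤ k ! ℕ.* (numerator ε ℕ.* k) ⊎ sumPerms k L nonFull ℕ.≤ k !)
    (length-tabulate key)
    (sumPerms-nonFull (numerator≤denominator ε ε≤½) L (tabulate-distinct U key injective)))
  where
  open FanOut α ε using (w)
  open NonFull U α ε using (nonFull; sumPerms-nonFull)
  L : List _
  L = tabulate key
  total : ℕ
  total = sumPerms n L nonFull
  instance
    n!≢0 : ℕ.NonZero (n !)
    n!≢0 = ℕₚ._!≢0 n
    w≢0 : ℕ.NonZero w
    w≢0 = ℕₚ.m*n≢0 (↧ₙ ε) α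
  mean : 𝔼 n (RBST.E U α ε key) ≡ + total / n !
  -- `RBST.E` unfolds to `nonFull` of the keys listed by priority, so `nonFull` can serve as the
  -- function summed over orders.
  mean = cong (λ k → + k / n !) (sum-permutations n key nonFull)
  conclude : w ℕ.* total ℕ.≤ n ! ℕ.* (numerator ε ℕ.* n) ⊎ total ℕ.≤ n ! →
    𝔼 n (RBST.E U α ε key) ≤ (ε * (+ n / α)) ⊔ 1ℚ
  conclude (inj₁ le) = ℚₚ.≤-trans (ℚₚ.≤-reflexive mean) (ℚₚ.≤-trans
    (/≤/ total (numerator ε ℕ.* n) (n !) w (ℕₚ.≤-trans (ℕₚ.≤-reflexive (ℕₚ.*-comm total w))
      (ℕₚ.≤-trans le (ℕₚ.≤-reflexive (ℕₚ.*-comm (n !) _)))))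
    (ℚₚ.≤-trans (ℚₚ.≤-reflexive (sym (*-/ ε n α))) (ℚₚ.p≤p⊔q (ε * (+ n / α)) 1ℚ)))
  conclude (inj₂ le) = ℚₚ.≤-trans (ℚₚ.≤-reflexive mean) (ℚₚ.≤-trans
    (/≤/ total 1 (n !) 1 (ℕₚ.≤-trans (ℕₚ.≤-reflexive (ℕₚ.*-identityʳ total))
      (ℕₚ.≤-trans le (ℕₚ.≤-reflexive (sym (ℕₚ.+-identityʳ (n !)))))))
    (ℚₚ.p≤q⊔p (ε * (+ n / α)) 1ℚ))
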